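{- Let $H$ be a realizable 3-uniform hypergraph and let $T$ be a realization of $H$. Let $M$ be a module of $H$. Suppose that $M$ is not a module of $T$, and set $$S_T(M)=\{v\in V(H)\setminus M:\ M \text{ is not a module of } T[M\cup\{v\}]\}.$$ Then the following four assertions hold: 1. $M\cup S_T(M)$ is a module of $T$; 2. $M$ is not a strong module of $H$; 3. $M\cup S_T(M)\subseteq\widetilde{M}^H$; 4. the quotient $H[\widetilde{M}^H]/\Pi(H[\widetilde{M}^H])$ is an empty hypergraph and $|\Pi(H[\widetilde{M}^H])|\geq 3$.
   Context: All structures are finite. A 3-uniform hypergraph $H$ consists of a vertex set $V(H)$ and an edge set $E(H)\subseteq\binom{V(H)}{3}$; it is empty if $E(H)=\emptyset$. For $W\subseteq V(H)$, $H[W]$ is the hypergraph with vertex set $W$ and edge set $\{e\in E(H):e\subseteq W\}$. A tournament $T$ has a vertex set $V(T)$ and an arc set $A(T)$ such that for distinct $v,w\in V(T)$ exactly one of $vw,wv$ belongs to $A(T)$; $T[W]$ denotes the subtournament induced by $W$. A 3-cycle is a tournament on three vertices isomorphic to $(\{0,1,2\},\{01,12,20\})$. The $C_3$-structure $C_3(T)$ of a tournament $T$ is the 3-uniform hypergraph on $V(T)$ whose edges are the 3-element subsets $X$ of $V(T)$ such that $T[X]$ is a 3-cycle. A tournament $T$ with $V(T)=V(H)$ is a realization of $H$ if $H=C_3(T)$; $H$ is realizable if it admits a realization. A subset $M$ of $V(H)$ is a module of the hypergraph $H$ if for each $e\in E(H)$ such that $e\cap M\neq\emptyset$ and $e\setminus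 M\neq\emptyset$, there exists $m\in M$ such that $e\cap M=\{m\}$ and for every $n\in M$, $(e\setminus\{m\})\cup\{n\}\in E(H)$. A subset $M$ of $V(T)$ is a module of the tournament $T$ if for any $x,y\in M$ and $v\in V(T)$, if $xv,vy\in A(T)$, then $v\in M$. A module $M$ of $H$ is strong if for every module $N$ of $H$ with $M\cap N\neq\emptyset$, we have $M\subseteq N$ or $N\subseteq M$. For nonempty $W\subseteq V(H)$, $\widetilde{W}^H$ denotes the intersection of the strong modules of $H$ containing $W$; it is the smallest strong module of $H$ containing $W$. When $|V(H)|\geq 2$, $\Pi(H)$ denotes the set of the strong modules of $H$ distinct from $V(H)$ that are maximal under inclusion among those; it is a partition of $V(H)$. For a partition $P$ of $V(H)$ into modules of $H$, the quotient $H/P$ is the hypergraph with vertex set $P$ such that $\mathcal{E}\subseteq P$ is an edge of $H/P$ iff $|\mathcal{E}|\geq 2$ and there exists $e\in E(H)$ with $\mathcal{E}=\{X\in P:X\cap e\neq\emptyset\}$. -}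

module Defs where

open import Level using (0ℓ)
import Data.Bool.Properties as Bool
open import Data.Empty using (⊥-elim)
open import Data.Fin using (Fin; zero; suc)
open import Data.Fin.Patterns using (0F; 1F; 2F)
import Data.Fin.Properties as Fin
open import Data.Fin.Subset
open import Data.Fin.Subset.Properties
open import Data.List as List using (List; []; _∷_; _++_; filter; length)
open import Data.List.Membership.Propositional using () renaming (_∈_ to _∈ˡ_)
open import Data.List.Membership.Propositional.Properties
  using (∈-map⁺; ∈-map⁻; ∈-++⁺ˡ; ∈-++⁺ʳ)
open import Data.List.Relation.Unary.All as All using ([])
open import Data.List.Relation.Unary.Any using (here)
open import Data.List.Relation.Unary.AllPairs using ([]; _∷_)
open import Data.List.Relation.Unary.Unique.Propositional using (Unique)
open import Data.List.Relation.Unary.Unique.Propositional.Properties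
  using (map⁺; ++⁺)
open import Data.Nat using (ℕ; zero; suc; _≥_)
import Data.Nat.Properties as ℕ
open import Data.Product using (Σ; ∃-syntax; _×_; _,_; proj₁; proj₂)
open import Data.Sum using (_⊎_; inj₁; inj₂)
open import Data.Vec using ([]; _∷_; here; there; tabulate)
open import Data.Vec.Properties
  using (≡-dec; ∷-injectiveʳ; lookup∘tabulate; lookup⇒[]=; []=⇒lookup)
open import Data.Vec.Properties.WithK using ([]=-irrelevant)
open import Function using (_∘_; _⇔_; mk⇔; Equivalence; Bijective)
open import Relation.Binary using (Rel)
import Relation.Binary as B
open import Relation.Binary.PropositionalEquality
  using (_≡_; _≢_; refl; sym; trans; cong; subst)
open import Relation.Nullary using (¬_; Dec; yes; no; does; contradiction)
open import Relation.Nullary.Decidable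
  using (map′; _×-dec_; _⊎-dec_; _→-dec_; ¬?; dec-true)
open import Relation.Unary using (Pred; Decidable; _≐_)

private
  variable
    m n : ℕ

------------------------------------------------------------------------
-- Finite subsets

infix 4 _≟ˢ_

_≟ˢ_ : B.DecidableEquality (Subset n)
_≟ˢ_ = ≡-dec Bool._≟_

-- The set { x | P x }.
comprehension : {P : Pred (Fin n) 0ℓ} → Decidable P → Subset n
comprehension P? = tabulate (does ∘ P?)

∈-comprehension : {P : Pred (Fin n) 0ℓ} (P? : Decidable P) →
                  ∀ {x} → x ∈ comprehension P? ⇔ P x
∈-comprehension {P = P} P? {x} = mk⇔ to from
  where
  to : x ∈ comprehension P? → P x
  to x∈ with P? x | trans (sym (lookup∘tabulate (does ∘ P?) x)) ([]=⇒lookup x∈)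
  ... | yes p | _  = p
  ... | no _  | ()

  from : P x → x ∈ comprehension P?
  from p = lookup⇒[]= x _
    (trans (lookup∘tabulate (does ∘ P?) x) (dec-true (P? x) p))

subsets : ∀ n → List (Subset n)
subsets zero    = [] ∷ []
subsets (suc n) =
  List.map (outside ∷_) (subsets n) ++ List.map (inside ∷_) (subsets n)

∈-subsets : (p : Subset n) → p ∈ˡ subsets n
∈-subsets []            = here refl
∈-subsets (outside ∷ p) = ∈-++⁺ˡ (∈-map⁺ (outside ∷_) (∈-subsets p))
∈-subsets (inside  ∷ p) = ∈-++⁺ʳ _ (∈-map⁺ (inside ∷_) (∈-subsets p))

subsets-unique : ∀ n → Unique (subsets n)
subsets-unique zero    = [] ∷ []
subsets-unique (suc n) =
  ++⁺ (map⁺ ∷-injectiveʳ (subsets-unique n))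
      (map⁺ ∷-injectiveʳ (subsets-unique n))
      disjoint
  where
  disjoint : ∀ {p} → ¬ (p ∈ˡ List.map (outside ∷_) (subsets n) ×
                        p ∈ˡ List.map (inside ∷_) (subsets n))
  disjoint (o , i) with ∈-map⁻ (outside ∷_) o | ∈-map⁻ (inside ∷_) i
  ... | _ , _ , refl | _ , _ , ()

allSubsets? : {P : Pred (Subset n) 0ℓ} → Decidable P → Dec (∀ p → P p)
allSubsets? {n} P? = map′ (λ ps p → All.lookup ps (∈-subsets p))
                          (λ f → All.tabulate (λ {p} _ → f p))
                          (All.all? P? (subsets n))

------------------------------------------------------------------------
-- Hypergraphs
--
-- Vertices are drawn from an ambient Fin n, so that H and the induced
-- hypergraphs H[W] live over the same type.

record Hypergraph (n : ℕ) : Set₁ where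
  field
    V   : Subset n
    E   : Pred (Subset n) 0ℓ
    E?  : Decidable E
    E⊆V : ∀ {e} → E e → e ⊆ V

open Hypergraph public

infix 4 _≈_

_≈_ : Hypergraph n → Hypergraph n → Set
H ≈ K = V H ≡ V K × E H ≐ E K

IsUniform : ℕ → Hypergraph n → Set
IsUniform k H = ∀ {e} → E H e → ∣ e ∣ ≡ k

IsEmpty : Hypergraph n → Set
IsEmpty H = ∀ e → ¬ E H e

infix 9 _[_]

_[_] : Hypergraph n → Subset n → Hypergraph n
(H [ W ]) .V               = W
(H [ W ]) .E e             = E H e × e ⊆ W
(H [ W ]) .E? e            = E? H e ×-dec e ⊆? W
(H [ W ]) .E⊆V (_ , e⊆W)   = e⊆W

IsModule : Hypergraph n → Pred (Subset n) 0ℓ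
IsModule H M = M ⊆ V H ×
  (∀ e → E H e → Nonempty (e ∩ M) → Nonempty (e ─ M) →
     ∃[ m ] m ∈ M × e ∩ M ≡ ⁅ m ⁆ ×
       (∀ n → n ∈ M → E H ((e - m) ∪ ⁅ n ⁆)))

isModule? : (H : Hypergraph n) → Decidable (IsModule H)
isModule? H M = M ⊆? V H ×-dec
  allSubsets? (λ e → E? H e →-dec nonempty? (e ∩ M) →-dec nonempty? (e ─ M) →-dec
    Fin.any? (λ m → m ∈? M ×-dec e ∩ M ≟ˢ ⁅ m ⁆ ×-dec
      Fin.all? (λ n → n ∈? M →-dec E? H ((e - m) ∪ ⁅ n ⁆))))

IsStrong : Hypergraph n → Pred (Subset n) 0ℓ
IsStrong H M = IsModule H M ×
  (∀ N → IsModule H N → Nonempty (M ∩ N) → M ⊆ N ⊎ N ⊆ M)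

isStrong? : (H : Hypergraph n) → Decidable (IsStrong H)
isStrong? H M = isModule? H M ×-dec
  allSubsets? (λ N → isModule? H N →-dec nonempty? (M ∩ N) →-dec
    (M ⊆? N ⊎-dec N ⊆? M))

-- The set W̃ᴴ, for W a nonempty subset of V H.  The family intersected is
-- then nonempty, since V H is itself a strong module.
strongClosure : Hypergraph n → Subset n → Subset n
strongClosure {n} H W =
  ⋂ (filter (λ N → isStrong? H N ×-dec W ⊆? N) (subsets n))

IsMaximalProperStrong : Hypergraph n → Pred (Subset n) 0ℓ
IsMaximalProperStrong H M = (IsStrong H M × M ≢ V H) ×
  (∀ N → IsStrong H N × N ≢ V H → M ⊆ N → N ≡ M)

isMaximalProperStrong? : (H : Hypergraph n) → Decidable (IsMaximalProperStrong H)
isMaximalProperStrong? H M = proper? M ×-dec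
  allSubsets? (λ N → proper? N →-dec M ⊆? N →-dec N ≟ˢ M)
  where
  proper? : Decidable (λ N → IsStrong H N × N ≢ V H)
  proper? N = isStrong? H N ×-dec ¬? (N ≟ˢ V H)

-- Without repetitions, by subsets-unique, so its length is |Π(H)|.
Π : Hypergraph n → List (Subset n)
Π {n} H = filter (isMaximalProperStrong? H) (subsets n)

-- { X ∈ P | X ∩ e ≠ ∅ }, a block being identified with its index in P.
trace : (P : List (Subset n)) → Subset n → Subset (length P)
trace P e = comprehension (λ i → nonempty? (List.lookup P i ∩ e))

-- The quotient H/P, meant for P a repetition-free list of the blocks of a
-- partition of V H into modules.  Its vertices are the indices of P.
infixl 8 _/_

_/_ : Hypergraph n → (P : List (Subset n)) → Hypergraph (length P)
(H / P) .V    = ⊤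
(H / P) .E 𝓔  = ∣ 𝓔 ∣ ≥ 2 × (∃[ e ] E H e × 𝓔 ≡ trace P e)
(H / P) .E? 𝓔 = ∣ 𝓔 ∣ ℕ.≥? 2 ×-dec anySubset? (λ e → E? H e ×-dec 𝓔 ≟ˢ trace P e)
(H / P) .E⊆V _ = λ _ → ∈⊤

------------------------------------------------------------------------
-- Tournaments

record Tournament (n : ℕ) : Set₁ where
  field
    Vₜ     : Subset n
    A      : Rel (Fin n) 0ℓ
    A?     : B.Decidable A
    A⊆V×V  : ∀ {v w} → A v w → v ∈ Vₜ × w ∈ Vₜ
    irrefl : ∀ {v} → ¬ A v v
    exactlyOne : ∀ {v w} → v ∈ Vₜ → w ∈ Vₜ → v ≢ w →
                 (A v w × ¬ A w v) ⊎ (¬ A v w × A w v)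

  Vertex : Set
  Vertex = Σ (Fin n) (_∈ Vₜ)

  asym : ∀ {v w} → A v w → ¬ A w v
  asym {v} {w} vw wv with v Fin.≟ w
  ... | yes refl = irrefl vw
  ... | no v≢w with exactlyOne (proj₁ (A⊆V×V vw)) (proj₂ (A⊆V×V vw)) v≢w
  ...   | inj₁ (_ , ¬wv) = ¬wv wv
  ...   | inj₂ (¬vw , _) = ¬vw vw

open Tournament public

-- The vertex set of T[W] is Vₜ T ∩ W, which is W whenever W ⊆ Vₜ T.
infix 9 _⟦_⟧

_⟦_⟧ : Tournament n → Subset n → Tournament n
(T ⟦ W ⟧) .Vₜ       = Vₜ T ∩ W
(T ⟦ W ⟧) .A v w    = A T v w × v ∈ W × w ∈ W
(T ⟦ W ⟧) .A? v w   = A? T v w ×-dec v ∈? W ×-dec w ∈? W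
(T ⟦ W ⟧) .A⊆V×V (vw , v∈W , w∈W) =
  x∈p∩q⁺ (proj₁ (A⊆V×V T vw) , v∈W) , x∈p∩q⁺ (proj₂ (A⊆V×V T vw) , w∈W)
(T ⟦ W ⟧) .irrefl (vv , _) = irrefl T vv
(T ⟦ W ⟧) .exactlyOne v∈ w∈ v≢w
  with x∈p∩q⁻ (Vₜ T) W v∈ | x∈p∩q⁻ (Vₜ T) W w∈
... | v∈V , v∈W | w∈V , w∈W with exactlyOne T v∈V w∈V v≢w
...   | inj₁ (vw , ¬wv) = inj₁ ((vw , v∈W , w∈W) , ¬wv ∘ proj₁)
...   | inj₂ (¬vw , wv) = inj₂ (¬vw ∘ proj₁ , (wv , w∈W , v∈W))

infix 4 _≅_

record _≅_ (T : Tournament m) (U : Tournament n) : Set where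
  field
    f         : Vertex T → Vertex U
    bijective : Bijective _≡_ _≡_ f
    arcs      : ∀ x y → A T (proj₁ x) (proj₁ y) ⇔ A U (proj₁ (f x)) (proj₁ (f y))

data C₃-Arc : Rel (Fin 3) 0ℓ where
  01∈ : C₃-Arc 0F 1F
  12∈ : C₃-Arc 1F 2F
  20∈ : C₃-Arc 2F 0F

C₃ : Tournament 3
C₃ .Vₜ = ⊤
C₃ .A = C₃-Arc
C₃ .A? 0F 0F = no λ ()
C₃ .A? 0F 1F = yes 01∈
C₃ .A? 0F 2F = no λ ()
C₃ .A? 1F 0F = no λ ()
C₃ .A? 1F 1F = no λ ()
C₃ .A? 1F 2F = yes 12∈
C₃ .A? 2F 0F = yes 20∈
C₃ .A? 2F 1F = no λ ()
C₃ .A? 2F 2F = no λ ()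
C₃ .A⊆V×V _ = ∈⊤ , ∈⊤
C₃ .irrefl ()
C₃ .exactlyOne {0F} {0F} _ _ v≢v = contradiction refl v≢v
C₃ .exactlyOne {0F} {1F} _ _ _ = inj₁ (01∈ , λ ())
C₃ .exactlyOne {0F} {2F} _ _ _ = inj₂ ((λ ()) , 20∈)
C₃ .exactlyOne {1F} {0F} _ _ _ = inj₂ ((λ ()) , 01∈)
C₃ .exactlyOne {1F} {1F} _ _ v≢v = contradiction refl v≢v
C₃ .exactlyOne {1F} {2F} _ _ _ = inj₁ (12∈ , λ ())
C₃ .exactlyOne {2F} {0F} _ _ _ = inj₁ (20∈ , λ ())
C₃ .exactlyOne {2F} {1F} _ _ _ = inj₂ ((λ ()) , 12∈)
C₃ .exactlyOne {2F} {2F} _ _ v≢v = contradiction refl v≢v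

Is3Cycle : Tournament n → Set
Is3Cycle T = C₃ ≅ T

is3Cycle⇔ : (T : Tournament n) →
  (∃[ a ] ∃[ b ] ∃[ c ] Vₜ T ⊆ ⁅ a ⁆ ∪ ⁅ b ⁆ ∪ ⁅ c ⁆ × A T a b × A T b c × A T c a)
  ⇔ Is3Cycle T
is3Cycle⇔ {n} T = mk⇔ to from
  where
  Cyclic : Set
  Cyclic = ∃[ a ] ∃[ b ] ∃[ c ]
    Vₜ T ⊆ ⁅ a ⁆ ∪ ⁅ b ⁆ ∪ ⁅ c ⁆ × A T a b × A T b c × A T c a

  vertex-≡ : {x y : Vertex T} → proj₁ x ≡ proj₁ y → x ≡ y
  vertex-≡ {x , p} {_ , q} refl = cong (x ,_) ([]=-irrelevant p q)

  to : Cyclic → C₃ ≅ T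
  to (a , b , c , V⊆ , ab , bc , ca) = record
    { f         = g ∘ proj₁
    ; bijective = (λ {x} {y} → inj x y) , surj
    ; arcs      = λ { (i , _) (j , _) → arcs′ i j }
    }
    where
    g : Fin 3 → Vertex T
    g 0F = a , proj₁ (A⊆V×V T ab)
    g 1F = b , proj₁ (A⊆V×V T bc)
    g 2F = c , proj₁ (A⊆V×V T ca)

    arcs′ : ∀ i j → C₃-Arc i j ⇔ A T (proj₁ (g i)) (proj₁ (g j))
    arcs′ 0F 0F = mk⇔ (λ ()) (⊥-elim ∘ irrefl T)
    arcs′ 0F 1F = mk⇔ (λ _ → ab) (λ _ → 01∈)
    arcs′ 0F 2F = mk⇔ (λ ()) (⊥-elim ∘ asym T ca)
    arcs′ 1F 0F = mk⇔ (λ ()) (⊥-elim ∘ asym T ab)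
    arcs′ 1F 1F = mk⇔ (λ ()) (⊥-elim ∘ irrefl T)
    arcs′ 1F 2F = mk⇔ (λ _ → bc) (λ _ → 12∈)
    arcs′ 2F 0F = mk⇔ (λ _ → ca) (λ _ → 20∈)
    arcs′ 2F 1F = mk⇔ (λ ()) (⊥-elim ∘ asym T bc)
    arcs′ 2F 2F = mk⇔ (λ ()) (⊥-elim ∘ irrefl T)

    inj′ : ∀ i j → g i ≡ g j → i ≡ j
    inj′ i j eq with i Fin.≟ j
    ... | yes i≡j = i≡j
    ... | no i≢j with exactlyOne C₃ {i} {j} ∈⊤ ∈⊤ i≢j
    ...   | inj₁ (ij , _) = contradiction
              (subst (λ v → A T (proj₁ v) (proj₁ (g j))) eq
                (Equivalence.to (arcs′ i j) ij)) (irrefl T)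
    ...   | inj₂ (_ , ji) = contradiction
              (subst (λ v → A T (proj₁ (g j)) (proj₁ v)) eq
                (Equivalence.to (arcs′ j i) ji)) (irrefl T)

    inj : ∀ (x y : Vertex C₃) → g (proj₁ x) ≡ g (proj₁ y) → x ≡ y
    inj (i , p) (j , q) eq with inj′ i j eq
    ... | refl = cong (i ,_) ([]=-irrelevant p q)

    surj : ∀ (y : Vertex T) → ∃[ x ] (∀ {z} → z ≡ x → g (proj₁ z) ≡ y)
    surj (v , v∈) with x∈p∪q⁻ ⁅ a ⁆ _ (V⊆ v∈)
    ... | inj₁ v∈a = (0F , ∈⊤) , λ { refl → vertex-≡ (sym (x∈⁅y⁆⇒x≡y a v∈a)) }
    ... | inj₂ v∈bc with x∈p∪q⁻ ⁅ b ⁆ _ v∈bc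
    ...   | inj₁ v∈b = (1F , ∈⊤) , λ { refl → vertex-≡ (sym (x∈⁅y⁆⇒x≡y b v∈b)) }
    ...   | inj₂ v∈c = (2F , ∈⊤) , λ { refl → vertex-≡ (sym (x∈⁅y⁆⇒x≡y c v∈c)) }

  from : C₃ ≅ T → Cyclic
  from iso = h 0F , h 1F , h 2F , V⊆ , arc 01∈ , arc 12∈ , arc 20∈
    where
    open _≅_ iso

    h : Fin 3 → Fin n
    h i = proj₁ (f (i , ∈⊤))

    arc : ∀ {i j} → C₃-Arc i j → A T (h i) (h j)
    arc {i} {j} = Equivalence.to (arcs (i , ∈⊤) (j , ∈⊤))

    h∈ : ∀ i → h i ∈ ⁅ h 0F ⁆ ∪ ⁅ h 1F ⁆ ∪ ⁅ h 2F ⁆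
    h∈ 0F = x∈p∪q⁺ (inj₁ (x∈⁅x⁆ _))
    h∈ 1F = x∈p∪q⁺ (inj₂ (x∈p∪q⁺ (inj₁ (x∈⁅x⁆ _))))
    h∈ 2F = x∈p∪q⁺ {p = ⁅ h 0F ⁆} (inj₂ (x∈p∪q⁺ {p = ⁅ h 1F ⁆} (inj₂ (x∈⁅x⁆ _))))

    V⊆ : Vₜ T ⊆ ⁅ h 0F ⁆ ∪ ⁅ h 1F ⁆ ∪ ⁅ h 2F ⁆
    V⊆ {v} v∈ with proj₂ bijective (v , v∈)
    ... | (i , p) , eq =
      subst (_∈ ⁅ h 0F ⁆ ∪ ⁅ h 1F ⁆ ∪ ⁅ h 2F ⁆) (cong proj₁ (eq {i , ∈⊤} i≡)) (h∈ i)
      where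
      i≡ : (i , ∈⊤) ≡ (i , p)
      i≡ = cong (i ,_) ([]=-irrelevant ∈⊤ p)

is3Cycle? : (T : Tournament n) → Dec (Is3Cycle T)
is3Cycle? T = map′ (Equivalence.to (is3Cycle⇔ T)) (Equivalence.from (is3Cycle⇔ T))
  (Fin.any? λ a → Fin.any? λ b → Fin.any? λ c →
    Vₜ T ⊆? ⁅ a ⁆ ∪ ⁅ b ⁆ ∪ ⁅ c ⁆ ×-dec A? T a b ×-dec A? T b c ×-dec A? T c a)

C₃-structure : Tournament n → Hypergraph n
C₃-structure T = record
  { V   = Vₜ T
  ; E   = λ X → X ⊆ Vₜ T × ∣ X ∣ ≡ 3 × Is3Cycle (T ⟦ X ⟧)
  ; E?  = λ X → X ⊆? Vₜ T ×-dec ∣ X ∣ ℕ.≟ 3 ×-dec is3Cycle? (T ⟦ X ⟧)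
  ; E⊆V = proj₁
  }

IsTournamentModule : Tournament n → Pred (Subset n) 0ℓ
IsTournamentModule T M = M ⊆ Vₜ T ×
  (∀ x y v → x ∈ M → y ∈ M → v ∈ Vₜ T → A T x v → A T v y → v ∈ M)

isTournamentModule? : (T : Tournament n) → Decidable (IsTournamentModule T)
isTournamentModule? T M = M ⊆? Vₜ T ×-dec
  Fin.all? (λ x → Fin.all? λ y → Fin.all? λ v →
    x ∈? M →-dec y ∈? M →-dec v ∈? Vₜ T →-dec A? T x v →-dec A? T v y →-dec v ∈? M)

-- S_T(M), stated over V(T), which is V(H) whenever T realizes H.
S : Tournament n → Subset n → Subset n
S T M = comprehension (λ v → v ∈? Vₜ T ×-dec ¬? (v ∈? M) ×-dec
          ¬? (isTournamentModule? (T ⟦ M ∪ ⁅ v ⁆ ⟧) M))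

_IsRealizationOf_ : Tournament n → Hypergraph n → Set
T IsRealizationOf H = H ≈ C₃-structure T

Realizable : Hypergraph n → Set₁
Realizable {n} H = ∃[ T ] T IsRealizationOf H

{-# OPTIONS --safe #-}

-- A vertex v ∈ S = S_T(M) satisfies x → v → y for some x , y ∈ M.  Exchanging the
-- vertex in M of a 3-cycle that meets M once shows that a vertex outside M ∪ S dominates
-- all of M ∪ S or is dominated by it, and that no 3-cycle within M ∪ S crosses M.  Nor does
-- any such 3-cycle cross N = S ∪ { u ∈ M | v → u }, as in M each in-neighbour of v dominates
-- each out-neighbour of v.  Hence N is a module of H overlapping M, so M is
-- not strong, and a strong module containing M must contain N.
--
-- The last assertion holds for any nonempty module M that is not strong in a 3-uniform H.
-- Let Z be the strong closure of M and X a maximal module with M ⊆ X ⊊ Z.  As X is not strong,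
-- it is overlapped by a module N, and X ∪ N = Z by maximality.  No edge of H[Z] crosses X, for
-- exchanging its vertex in X for one in X ─ N would give an edge meeting N in two vertices and
-- leaving it.  So H[Z] is disconnected.  Its connected components are proper strong modules,
-- hence each edge lies within one block of Π(H[Z]).
module Submission where

open import Data.Nat using (ℕ; _≥_)
open import Data.Fin.Subset using (Subset; _∪_; _⊆_)
open import Data.List using (length)
open import Data.Product using (_×_)
open import Relation.Nullary using (¬_)
open import Defs

open import Level using (0ℓ)
open import Data.Empty using (⊥; ⊥-elim)
open import Data.Fin using (Fin; zero; suc)
open import Data.Fin.Properties using (any?; _≟_)
open import Data.Fin.Subset
  using (_∈_; _∉_; _⊈_; _⊂_; _⊃_; _∩_; _─_; _-_; ⁅_⁆; ∣_∣; Nonempty; inside; outside; ⋂)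
open import Data.Fin.Subset.Properties
open import Data.Fin.Subset.Induction using (Acc; acc; ⊂-wellFounded; ⊃-wellFounded)
open import Data.List using (List; []; _∷_; lookup; filter)
open import Data.List.Membership.Propositional using () renaming (_∈_ to _∈ˡ_)
open import Data.List.Membership.Propositional.Properties
  using (∈-lookup; ∈-filter⁺; ∈-filter⁻)
open import Data.List.Relation.Unary.All as All using (All; []; _∷_)
open import Data.List.Relation.Unary.Any using (here; there)
open import Data.List.Relation.Unary.AllPairs using (_∷_)
open import Data.List.Relation.Unary.Unique.Propositional using (Unique)
open import Data.List.Relation.Unary.Unique.Propositional.Properties using (filter⁺)
open import Data.Nat using (suc; _≤_; z≤n; s≤s)
import Data.Nat.Properties as ℕ
open import Data.Product using (_,_; proj₁; proj₂; ∃-syntax)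
open import Data.Sum using (_⊎_; inj₁; inj₂; [_,_]′; swap)
open import Data.Vec using ([]; _∷_; here; there)
open import Function using (_∘_; Equivalence)
open import Relation.Binary.PropositionalEquality
  using (_≡_; _≢_; refl; sym; trans; cong; subst; subst₂)
open import Relation.Nullary using (yes; no; contradiction)
open import Relation.Nullary.Decidable
  using (_×-dec_; _⊎-dec_; _→-dec_; ¬?; decidable-stable)
open import Relation.Unary using (Pred; Decidable)

private
  variable
    n : ℕ
    x y z u k m o : Fin n
    p q e M N W X Z : Subset n

-- Finite subsets

x∈p─q⇒x∉q : (p q : Subset n) → x ∈ p ─ q → x ∉ q
x∈p─q⇒x∉q (_ ∷ p) (inside ∷ q) (there x∈) (there x∈q) = x∈p─q⇒x∉q p q x∈ x∈q
x∈p─q⇒x∉q (_ ∷ p) (outside ∷ q) (there x∈) (there x∈q) = x∈p─q⇒x∉q p q x∈ x∈q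

⊈⇒∃ : p ⊈ q → ∃[ x ] x ∈ p × x ∉ q
⊈⇒∃ {p = p} {q} p⊈q with nonempty? (p ─ q)
... | yes (x , x∈) = x , p─q⊆p p q x∈ , x∈p─q⇒x∉q p q x∈
... | no empty = ⊥-elim (p⊈q λ {x} x∈p →
        decidable-stable (x ∈? q) λ x∉q → empty (x , x∈p∧x∉q⇒x∈p─q x∈p x∉q))

∣⁅x⁆∪p∣≡1+∣p∣ : x ∉ p → ∣ ⁅ x ⁆ ∪ p ∣ ≡ suc ∣ p ∣
∣⁅x⁆∪p∣≡1+∣p∣ {x = zero}  {p = outside ∷ p} _ = cong (suc ∘ ∣_∣) (∪-identityˡ p)
∣⁅x⁆∪p∣≡1+∣p∣ {x = zero}  {p = inside ∷ p} x∉ = contradiction here x∉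
∣⁅x⁆∪p∣≡1+∣p∣ {x = suc x} {p = outside ∷ p} x∉ = ∣⁅x⁆∪p∣≡1+∣p∣ (x∉ ∘ there)
∣⁅x⁆∪p∣≡1+∣p∣ {x = suc x} {p = inside ∷ p} x∉ = cong suc (∣⁅x⁆∪p∣≡1+∣p∣ (x∉ ∘ there))

∣⁅x⁆∪p∣≤1+∣p∣ : (x : Fin n) (p : Subset n) → ∣ ⁅ x ⁆ ∪ p ∣ ≤ suc ∣ p ∣
∣⁅x⁆∪p∣≤1+∣p∣ x p with x ∈? p
... | no x∉p = ℕ.≤-reflexive (∣⁅x⁆∪p∣≡1+∣p∣ x∉p)
... | yes x∈p = ℕ.m≤n⇒m≤1+n (p⊆q⇒∣p∣≤∣q∣ ⁅x⁆∪p⊆p)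
  where
  ⁅x⁆∪p⊆p : ⁅ x ⁆ ∪ p ⊆ p
  ⁅x⁆∪p⊆p y∈ with x∈p∪q⁻ ⁅ x ⁆ p y∈
  ... | inj₁ y∈x rewrite x∈⁅y⁆⇒x≡y x y∈x = x∈p
  ... | inj₂ y∈p = y∈p

∣p∣≥2⇒other : ∣ p ∣ ≥ 2 → (x : Fin n) → ∃[ y ] y ∈ p × y ≢ x
∣p∣≥2⇒other {p = p} 2≤ x with p ⊆? ⁅ x ⁆
... | yes p⊆ = contradiction
        (ℕ.≤-trans 2≤ (subst (∣ p ∣ ≤_) (∣⁅x⁆∣≡1 x) (p⊆q⇒∣p∣≤∣q∣ p⊆))) ℕ.1+n≰n
... | no p⊈ with ⊈⇒∃ p⊈
...   | y , y∈p , y∉x = y , y∈p , x∉⁅y⁆⇒x≢y y∉x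

∣p∣≥2⇒two : {p : Subset n} → ∣ p ∣ ≥ 2 → ∃[ x ] ∃[ y ] x ∈ p × y ∈ p × x ≢ y
∣p∣≥2⇒two {p = p} 2≤ with nonempty? p
... | yes (x , x∈p) with ∣p∣≥2⇒other 2≤ x
...   | y , y∈p , y≢x = x , y , x∈p , y∈p , y≢x ∘ sym
∣p∣≥2⇒two {n = n} 2≤ | no empty rewrite Empty-unique empty | ∣⊥∣≡0 n with () ← 2≤

∣p∣≥3⇒other : ∣ p ∣ ≥ 3 → (x y : Fin n) → ∃[ z ] z ∈ p × z ≢ x × z ≢ y
∣p∣≥3⇒other {p = p} 3≤ x y with p ⊆? ⁅ x ⁆ ∪ ⁅ y ⁆
... | yes p⊆ = contradiction
        (ℕ.≤-trans 3≤ (ℕ.≤-trans (p⊆q⇒∣p∣≤∣q∣ p⊆)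
          (subst (λ k → ∣ ⁅ x ⁆ ∪ ⁅ y ⁆ ∣ ≤ suc k) (∣⁅x⁆∣≡1 y) (∣⁅x⁆∪p∣≤1+∣p∣ x ⁅ y ⁆))))
        ℕ.1+n≰n
... | no p⊈ with ⊈⇒∃ p⊈
...   | z , z∈p , z∉ = z , z∈p ,
        (λ { refl → z∉ (x∈p∪q⁺ (inj₁ (x∈⁅x⁆ x))) }) ,
        (λ { refl → z∉ (x∈p∪q⁺ {p = ⁅ x ⁆} (inj₂ (x∈⁅x⁆ y))) })

IsMinimal IsMaximal : Pred (Subset n) 0ℓ → Pred (Subset n) 0ℓ
IsMinimal P q = P q × (∀ r → P r → r ⊆ q → q ⊆ r)
IsMaximal P q = P q × (∀ r → P r → q ⊆ r → r ⊆ q)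

minimal : {P : Pred (Subset n) 0ℓ} → Decidable P →
          ∀ p → P p → ∃[ q ] q ⊆ p × IsMinimal P q
minimal {P = P} P? p Pp = go p Pp (⊂-wellFounded p)
  where
  go : ∀ p → P p → Acc _⊂_ p → ∃[ q ] q ⊆ p × IsMinimal P q
  go p Pp (acc rs) with anySubset? (λ r → P? r ×-dec r ⊆? p ×-dec ¬? (p ⊆? r))
  ... | no none = p , (λ x∈ → x∈) , Pp , λ r Pr r⊆p →
          decidable-stable (p ⊆? r) λ p⊈r → none (r , Pr , r⊆p , p⊈r)
  ... | yes (r , Pr , r⊆p , p⊈r) with go r Pr (rs (r⊆p , ⊈⇒∃ p⊈r))
  ...   | q , q⊆r , min = q , (λ x∈ → r⊆p (q⊆r x∈)) , min

maximal : {P : Pred (Subset n) 0ℓ} → Decidable P →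
          ∀ p → P p → ∃[ q ] p ⊆ q × IsMaximal P q
maximal {P = P} P? p Pp = go p Pp (⊃-wellFounded p)
  where
  go : ∀ p → P p → Acc _⊃_ p → ∃[ q ] p ⊆ q × IsMaximal P q
  go p Pp (acc rs) with anySubset? (λ r → P? r ×-dec p ⊆? r ×-dec ¬? (r ⊆? p))
  ... | no none = p , (λ x∈ → x∈) , Pp , λ r Pr p⊆r →
          decidable-stable (r ⊆? p) λ r⊈p → none (r , Pr , p⊆r , r⊈p)
  ... | yes (r , Pr , p⊆r , r⊈p) with go r Pr (rs (p⊆r , ⊈⇒∃ r⊈p))
  ...   | q , r⊆q , max = q , (λ x∈ → r⊆q (p⊆r x∈)) , max

∈-⋂⁺ : {ps : List (Subset n)} → All (x ∈_) ps → x ∈ ⋂ ps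
∈-⋂⁺ []         = ∈⊤
∈-⋂⁺ (x∈ ∷ xs∈) = x∈p∩q⁺ (x∈ , ∈-⋂⁺ xs∈)

∈-⋂⁻ : {ps : List (Subset n)} → x ∈ ⋂ ps → All (x ∈_) ps
∈-⋂⁻ {ps = []}     _  = []
∈-⋂⁻ {ps = p ∷ ps} x∈ with x∈p∩q⁻ p (⋂ ps) x∈
... | x∈p , x∈ps = x∈p ∷ ∈-⋂⁻ x∈ps

lookup-injective : {A : Set} {xs : List A} → Unique xs →
                   ∀ i j → lookup xs i ≡ lookup xs j → i ≡ j
lookup-injective (_ ∷ _) zero zero _ = refl
lookup-injective (x∉ ∷ _) zero (suc j) eq = contradiction eq (All.lookup x∉ (∈-lookup j))
lookup-injective (x∉ ∷ _) (suc i) zero eq =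
  contradiction (sym eq) (All.lookup x∉ (∈-lookup i))
lookup-injective (_ ∷ u) (suc i) (suc j) eq = cong suc (lookup-injective u i j eq)

-- Pigeonhole: in a list of length at most two, two of the three memberships point to the same
-- position.
three∈⇒length≥3 : {A : Set} {xs : List A} {a b c : A} →
                  a ∈ˡ xs → b ∈ˡ xs → c ∈ˡ xs → a ≢ b → a ≢ c → b ≢ c → length xs ≥ 3
three∈⇒length≥3 {xs = _ ∷ _ ∷ _ ∷ _} _ _ _ _ _ _ = s≤s (s≤s (s≤s z≤n))
three∈⇒length≥3 (here refl) (here refl) _ a≢b _ _ = contradiction refl a≢b
three∈⇒length≥3 (here refl) (there _) (here refl) _ a≢c _ = contradiction refl a≢c
three∈⇒length≥3 (there _) (here refl) (here refl) _ _ b≢c = contradiction refl b≢c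
three∈⇒length≥3 {xs = _ ∷ _ ∷ []} (there (here refl)) (there (here refl)) _ a≢b _ _ =
  contradiction refl a≢b
three∈⇒length≥3 {xs = _ ∷ _ ∷ []} (there (here refl)) (here _) (there (here refl)) _ a≢c _ =
  contradiction refl a≢c
three∈⇒length≥3 {xs = _ ∷ _ ∷ []} (here _) (there (here refl)) (there (here refl)) _ _ b≢c =
  contradiction refl b≢c

-- Modules

exchange : Subset n → Fin n → Fin n → Subset n
exchange e m k = (e - m) ∪ ⁅ k ⁆

∈-exchange-new : k ∈ exchange e m k
∈-exchange-new {k = k} {e = e} {m} = x∈p∪q⁺ {p = e - m} (inj₂ (x∈⁅x⁆ k))

∈-exchange-old : x ∈ e → x ≢ m → x ∈ exchange e m k
∈-exchange-old x∈e x≢m = x∈p∪q⁺ (inj₁ (x∈p∧x≢y⇒x∈p-y x∈e x≢m))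

∈-exchange⁻ : x ∈ exchange e m k → (x ∈ e × x ≢ m) ⊎ x ≡ k
∈-exchange⁻ {e = e} {m} {k} x∈ with x∈p∪q⁻ (e - m) ⁅ k ⁆ x∈
... | inj₁ x∈e-m = inj₁ (p─q⊆p e ⁅ m ⁆ x∈e-m , x∉⁅y⁆⇒x≢y (x∈p─q⇒x∉q e ⁅ m ⁆ x∈e-m))
... | inj₂ x∈k = inj₂ (x∈⁅y⁆⇒x≡y k x∈k)

-- Either `c` is new to `e` or `c` is `m`, so taking `c` out again leaves exactly `e - m`.
exchange-exchange : {c : Fin n} → (c ∈ e → c ≡ m) →
                    exchange (exchange e m c) c k ≡ exchange e m k
exchange-exchange {e = e} {m} {k} {c} c∈e⇒ = ⊆-antisym to from
  where
  to : exchange (exchange e m c) c k ⊆ exchange e m k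
  to {x} x∈ with ∈-exchange⁻ {x = x} {e = exchange e m c} {m = c} x∈
  ... | inj₂ refl = ∈-exchange-new {e = e}
  ... | inj₁ (x∈′ , x≢c) with ∈-exchange⁻ {x = x} {e = e} {m = m} x∈′
  ...   | inj₁ (x∈e , x≢m) = ∈-exchange-old x∈e x≢m
  ...   | inj₂ x≡c = contradiction x≡c x≢c

  from : exchange e m k ⊆ exchange (exchange e m c) c k
  from {x} x∈ with ∈-exchange⁻ {x = x} {e = e} {m = m} x∈
  ... | inj₂ refl = ∈-exchange-new {e = exchange e m c}
  ... | inj₁ (x∈e , x≢m) =
          ∈-exchange-old (∈-exchange-old x∈e x≢m) λ { refl → x≢m (c∈e⇒ x∈e) }

-- The module condition in pointwise form: `m` is any given vertex of `e` in `M`, not an existential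
-- witness, and no equality of sets has to be handled.
ExchangesAt : Hypergraph n → Subset n → Subset n → Fin n → Set
ExchangesAt H M e m = (∀ {x} → x ∈ e → x ∈ M → x ≡ m) × (∀ {k} → k ∈ M → E H (exchange e m k))

Exchanges : Hypergraph n → Subset n → Set
Exchanges H M = ∀ {e m o} → E H e → m ∈ e → m ∈ M → o ∈ e → o ∉ M → ExchangesAt H M e m

module _ (H : Hypergraph n) where

  exchanges : IsModule H M → Exchanges H M
  exchanges {M} (_ , modular) {e} {m} {o} Ee m∈e m∈M o∈e o∉M
    with modular e Ee (m , x∈p∩q⁺ (m∈e , m∈M)) (o , x∈p∧x∉q⇒x∈p─q o∈e o∉M)
  -- The witness `m′` has to be the given `m`, since `e ∩ M` is a singleton containing both.
  ... | m′ , _ , e∩M≡ , swaps =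
        (λ x∈e x∈M → trans (≡m′ x∈e x∈M) (sym m≡m′)) ,
        λ {k} k∈M → subst (λ i → E H (exchange e i k)) (sym m≡m′) (swaps k k∈M)
    where
    ≡m′ : ∀ {x} → x ∈ e → x ∈ M → x ≡ m′
    ≡m′ x∈e x∈M = x∈⁅y⁆⇒x≡y m′ (subst (_ ∈_) e∩M≡ (x∈p∩q⁺ (x∈e , x∈M)))

    m≡m′ : m ≡ m′
    m≡m′ = ≡m′ m∈e m∈M

  exchanges⇒module : M ⊆ V H → Exchanges H M → IsModule H M
  exchanges⇒module {M} M⊆V exch = M⊆V , modular
    where
    modular : ∀ e → E H e → Nonempty (e ∩ M) → Nonempty (e ─ M) →
              ∃[ m ] m ∈ M × e ∩ M ≡ ⁅ m ⁆ × (∀ k → k ∈ M → E H (exchange e m k))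
    modular e Ee (m , m∈) (o , o∈) with x∈p∩q⁻ e M m∈
    ... | m∈e , m∈M with exch Ee m∈e m∈M (p─q⊆p e M o∈) (x∈p─q⇒x∉q e M o∈)
    ...   | unique , swaps = m , m∈M , ⊆-antisym
              (λ x∈ → let x∈e , x∈M = x∈p∩q⁻ e M x∈ in
                subst (_∈ ⁅ m ⁆) (sym (unique x∈e x∈M)) (x∈⁅x⁆ m))
              (λ x∈ → subst (_∈ e ∩ M) (sym (x∈⁅y⁆⇒x≡y m x∈)) m∈) ,
              λ _ → swaps

-- Unions of modules, modules of `H [ Z ]`, and the strong closure

module _ (H : Hypergraph n) where

  -- The common vertex `c` is a stepping stone: exchanging `m` for `c` within `X` gives an edge
  -- meeting `N` in `c`, and exchanging `c` within `N` then reaches every vertex of `N`.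
  ∪-exchangesˡ : {c : Fin n} → IsModule H X → IsModule H N → c ∈ X → c ∈ N →
                 E H e → m ∈ e → m ∈ X → o ∈ e → o ∉ X → o ∉ N →
                 (∀ {x} → x ∈ e → x ∈ X ⊎ x ∈ N → x ≡ m) ×
                 (∀ {k} → k ∈ X ⊎ k ∈ N → E H (exchange e m k))
  ∪-exchangesˡ {X} {N} {e} {m} {o} {c} modX modN c∈X c∈N Ee m∈e m∈X o∈e o∉X o∉N = unique , swaps
    where
    atX : ExchangesAt H X e m
    atX = exchanges H modX Ee m∈e m∈X o∈e o∉X

    e′ : Subset _
    e′ = exchange e m c

    atN : ExchangesAt H N e′ c
    atN = exchanges H modN (proj₂ atX c∈X) (∈-exchange-new {e = e}) c∈N
            (∈-exchange-old o∈e λ { refl → o∉X m∈X }) o∉N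

    unique : ∀ {x} → x ∈ e → x ∈ X ⊎ x ∈ N → x ≡ m
    unique x∈e (inj₁ x∈X) = proj₁ atX x∈e x∈X
    unique {x} x∈e (inj₂ x∈N) with x ≟ m
    ... | yes x≡m = x≡m
    -- Here `x` survives in `e′`, which meets `N` only in `c`; so `x` is `c`, which lies in `X`.
    ... | no x≢m with proj₁ atN (∈-exchange-old x∈e x≢m) x∈N
    ...   | refl = proj₁ atX x∈e c∈X

    swaps : ∀ {k} → k ∈ X ⊎ k ∈ N → E H (exchange e m k)
    swaps (inj₁ k∈X) = proj₂ atX k∈X
    swaps (inj₂ k∈N) = subst (E H) (exchange-exchange λ c∈e → proj₁ atX c∈e c∈X) (proj₂ atN k∈N)

  ∪-module : {c : Fin n} → IsModule H X → IsModule H N → c ∈ X → c ∈ N → IsModule H (X ∪ N)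
  ∪-module {X} {N} modX modN c∈X c∈N =
    exchanges⇒module H ([ proj₁ modX , proj₁ modN ]′ ∘ x∈p∪q⁻ X N) exch
    where
    exch : Exchanges H (X ∪ N)
    exch {e} {m} {o} Ee m∈e m∈ o∈e o∉ with x∈p∪q⁻ X N m∈
    ... | inj₁ m∈X =
      let unique , swaps = ∪-exchangesˡ modX modN c∈X c∈N Ee m∈e m∈X o∈e
                             (o∉ ∘ x∈p∪q⁺ ∘ inj₁) (o∉ ∘ x∈p∪q⁺ ∘ inj₂)
      in (λ x∈e → unique x∈e ∘ x∈p∪q⁻ X N) , swaps ∘ x∈p∪q⁻ X N
    ... | inj₂ m∈N =
      let unique , swaps = ∪-exchangesˡ modN modX c∈N c∈X Ee m∈e m∈N o∈e
                             (o∉ ∘ x∈p∪q⁺ ∘ inj₂) (o∉ ∘ x∈p∪q⁺ ∘ inj₁)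
      in (λ x∈e → unique x∈e ∘ swap ∘ x∈p∪q⁻ X N) , swaps ∘ swap ∘ x∈p∪q⁻ X N

  module-[]⁺ : IsModule H N → N ⊆ Z → IsModule (H [ Z ]) N
  module-[]⁺ {N} {Z} modN N⊆Z = exchanges⇒module (H [ Z ]) N⊆Z exch
    where
    exch : Exchanges (H [ Z ]) N
    exch {e} {m} (Ee , e⊆Z) m∈e m∈N o∈e o∉N =
      let unique , swaps = exchanges H modN Ee m∈e m∈N o∈e o∉N
      in unique , λ k∈N → swaps k∈N ,
           [ e⊆Z ∘ proj₁ , (λ { refl → N⊆Z k∈N }) ]′ ∘ ∈-exchange⁻ {e = e} {m = m}

  -- An edge inside `Z` is exchanged by `N` in `H [ Z ]`; an edge leaving `Z` is exchanged by `Z`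
  -- itself, which contains `N`.
  module-[]⁻ : IsModule H Z → IsModule (H [ Z ]) N → IsModule H N
  module-[]⁻ {Z} {N} modZ modN =
    exchanges⇒module H (λ x∈N → proj₁ modZ (proj₁ modN x∈N)) exch
    where
    exch : Exchanges H N
    exch {e} Ee m∈e m∈N o∈e o∉N with e ⊆? Z
    ... | yes e⊆Z =
      let unique , swaps = exchanges (H [ Z ]) modN (Ee , e⊆Z) m∈e m∈N o∈e o∉N
      in unique , proj₁ ∘ swaps
    ... | no e⊈Z with ⊈⇒∃ e⊈Z
    ...   | o′ , o′∈e , o′∉Z =
      let unique , swaps = exchanges H modZ Ee m∈e (proj₁ modN m∈N) o′∈e o′∉Z
      in (λ x∈e x∈N → unique x∈e (proj₁ modN x∈N)) , λ k∈N → swaps (proj₁ modN k∈N)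

  -- A module meeting `N` meets the strong module `Z`. It either contains `Z`, hence `N`, or lies in
  -- `Z` and is a module of `H [ Z ]`.
  strong-[]⁻ : IsStrong H Z → IsStrong (H [ Z ]) N → IsStrong H N
  strong-[]⁻ {Z} {N} (modZ , cmpZ) (modN , cmpN) = module-[]⁻ modZ modN , cmp
    where
    cmp : ∀ L → IsModule H L → Nonempty (N ∩ L) → N ⊆ L ⊎ L ⊆ N
    cmp L modL (c , c∈) with x∈p∩q⁻ N L c∈
    ... | c∈N , c∈L with cmpZ L modL (c , x∈p∩q⁺ (proj₁ modN c∈N , c∈L))
    ...   | inj₁ Z⊆L = inj₁ λ x∈N → Z⊆L (proj₁ modN x∈N)
    ...   | inj₂ L⊆Z = cmpN L (module-[]⁺ modL L⊆Z) (c , c∈)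

  V-strong : IsStrong H (V H)
  V-strong = exchanges⇒module H (λ x∈ → x∈) (λ Ee _ _ o∈e o∉V → contradiction (E⊆V H Ee o∈e) o∉V) ,
             λ _ modN _ → inj₂ (proj₁ modN)

  strong-comparable : {c : Fin n} → IsStrong H M → IsModule H N → c ∈ M → c ∈ N → M ⊆ N ⊎ N ⊆ M
  strong-comparable {c = c} (_ , cmp) modN c∈M c∈N = cmp _ modN (c , x∈p∩q⁺ (c∈M , c∈N))

  ¬strong⇒overlap : IsModule H M → ¬ IsStrong H M →
                    ∃[ N ] IsModule H N × Nonempty (M ∩ N) × M ⊈ N × N ⊈ M
  ¬strong⇒overlap {M} modM ¬strong
    with anySubset? (λ N → isModule? H N ×-dec nonempty? (M ∩ N) ×-dec ¬? (M ⊆? N) ×-dec ¬? (N ⊆? M))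
  ... | yes found = found
  ... | no none = ⊥-elim (¬strong (modM , cmp))
    where
    cmp : ∀ N → IsModule H N → Nonempty (M ∩ N) → M ⊆ N ⊎ N ⊆ M
    cmp N modN ne with M ⊆? N | N ⊆? M
    ... | yes M⊆N | _ = inj₁ M⊆N
    ... | no _ | yes N⊆M = inj₂ N⊆M
    ... | no M⊈N | no N⊈M = contradiction (N , modN , ne , M⊈N , N⊈M) none

  strongClosure-least : IsStrong H N → W ⊆ N → strongClosure H W ⊆ N
  strongClosure-least {N} strong W⊆N x∈ =
    All.lookup (∈-⋂⁻ x∈) (∈-filter⁺ (λ N → isStrong? H N ×-dec _ ⊆? N) (∈-subsets N) (strong , W⊆N))

  -- The strong modules containing W form a chain, so their intersection is the least of them.
  strongClosure-strong : Nonempty W → W ⊆ V H → IsStrong H (strongClosure H W) × W ⊆ strongClosure H W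
  strongClosure-strong {W} (w , w∈W) W⊆V =
    subst (IsStrong H) Q≡ strongQ , subst (W ⊆_) Q≡ W⊆Q
    where
    least-strong : ∃[ Q ] Q ⊆ V H × IsMinimal (λ N → IsStrong H N × W ⊆ N) Q
    least-strong = minimal (λ N → isStrong? H N ×-dec W ⊆? N) (V H) (V-strong , W⊆V)

    Q : Subset n
    Q = proj₁ least-strong

    strongQ : IsStrong H Q
    strongQ = proj₁ (proj₁ (proj₂ (proj₂ least-strong)))

    W⊆Q : W ⊆ Q
    W⊆Q = proj₂ (proj₁ (proj₂ (proj₂ least-strong)))

    Q⊆ : ∀ N → IsStrong H N → W ⊆ N → Q ⊆ N
    Q⊆ N strongN W⊆N =
      compare (strong-comparable strongQ (proj₁ strongN) (W⊆Q w∈W) (W⊆N w∈W))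
      where
      compare : Q ⊆ N ⊎ N ⊆ Q → Q ⊆ N
      compare (inj₁ Q⊆N) = Q⊆N
      compare (inj₂ N⊆Q) = proj₂ (proj₂ (proj₂ least-strong)) N (strongN , W⊆N) N⊆Q

    Q≡ : Q ≡ strongClosure H W
    Q≡ = ⊆-antisym
      (λ x∈Q → ∈-⋂⁺ (All.tabulate λ {N} N∈ →
        let _ , strongN , W⊆N = ∈-filter⁻ (λ N → isStrong? H N ×-dec W ⊆? N) {xs = subsets n} N∈
        in Q⊆ N strongN W⊆N x∈Q))
      (strongClosure-least strongQ W⊆Q)

-- Connected components

-- A union of connected components of H.
IsClosed : Hypergraph n → Pred (Subset n) 0ℓ
IsClosed H W = ∀ e → E H e → Nonempty (e ∩ W) → e ⊆ W

isClosed? : (H : Hypergraph n) → Decidable (IsClosed H)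
isClosed? H W = allSubsets? λ e → E? H e →-dec nonempty? (e ∩ W) →-dec e ⊆? W

-- The connected component of `x`, obtained by minimality among closed sets instead of by paths.
IsComponentOf : Hypergraph n → Fin n → Pred (Subset n) 0ℓ
IsComponentOf H x = IsMinimal λ D → IsClosed H D × D ⊆ V H × x ∈ D

module _ (H : Hypergraph n) where

  component : x ∈ V H → ∃[ D ] IsComponentOf H x D
  component {x} x∈V =
    let D , _ , comp = minimal (λ D → isClosed? H D ×-dec D ⊆? V H ×-dec x ∈? D) (V H)
                         ((λ _ Ee _ → E⊆V H Ee) , (λ x∈ → x∈) , x∈V)
    in D , comp

  closed⇒module : IsClosed H W → W ⊆ V H → IsModule H W
  closed⇒module closed W⊆V = exchanges⇒module H W⊆V λ Ee m∈e m∈W o∈e o∉W →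
    contradiction (closed _ Ee (_ , x∈p∩q⁺ (m∈e , m∈W)) o∈e) o∉W

  -- Both `D ∩ N` and `D ─ N` are closed, as no edge inside `D` crosses `N`. By minimality the one
  -- containing `x` is all of `D`.
  component-unsplittable : {D : Subset n} → IsComponentOf H x D →
    (∀ e → E H e → e ⊆ D → Nonempty (e ∩ N) → e ⊆ N) →
    D ⊆ N ⊎ (∀ {y} → y ∈ D → y ∉ N)
  component-unsplittable {x} {N} {D} ((closed , D⊆V , x∈D) , least) unsplit with x ∈? N
  ... | yes x∈N = inj₁ λ y∈D → proj₂ (x∈p∩q⁻ D N (least (D ∩ N)
          (closed′ , (λ y∈ → D⊆V (p∩q⊆p D N y∈)) , x∈p∩q⁺ (x∈D , x∈N)) (p∩q⊆p D N) y∈D))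
    where
    closed′ : IsClosed H (D ∩ N)
    closed′ e Ee (y , y∈) {z} z∈e with x∈p∩q⁻ e (D ∩ N) y∈
    ... | y∈e , y∈DN with x∈p∩q⁻ D N y∈DN
    ...   | y∈D , y∈N = x∈p∩q⁺ (e⊆D z∈e , unsplit e Ee e⊆D (y , x∈p∩q⁺ (y∈e , y∈N)) z∈e)
      where
      e⊆D : e ⊆ D
      e⊆D = closed e Ee (y , x∈p∩q⁺ (y∈e , y∈D))
  ... | no x∉N = inj₂ λ y∈D → x∈p─q⇒x∉q D N (least (D ─ N)
          (closed′ , (λ y∈ → D⊆V (p─q⊆p D N y∈)) , x∈p∧x∉q⇒x∈p─q x∈D x∉N) (p─q⊆p D N) y∈D)
    where
    closed′ : IsClosed H (D ─ N)
    closed′ e Ee (y , y∈) {z} z∈e with x∈p∩q⁻ e (D ─ N) y∈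
    ... | y∈e , y∈D─N = x∈p∧x∉q⇒x∈p─q (e⊆D z∈e) λ z∈N →
            x∈p─q⇒x∉q D N y∈D─N (unsplit e Ee e⊆D (z , x∈p∩q⁺ (z∈e , z∈N)) y∈e)
      where
      e⊆D : e ⊆ D
      e⊆D = closed e Ee (y , x∈p∩q⁺ (y∈e , p─q⊆p D N y∈D─N))

  -- If `D` were all of `V H`, the closed set `W` would split it.
  component-proper : {D : Subset n} → IsComponentOf H x D →
                     IsClosed H W → Nonempty W → W ⊆ V H → V H ⊈ W → D ≢ V H
  component-proper comp closed (w , w∈W) W⊆V V⊈W D≡V
    with component-unsplittable comp (λ e Ee _ → closed e Ee)
  ... | inj₁ D⊆W = V⊈W (subst (_⊆ _) D≡V D⊆W)
  ... | inj₂ D∉W = D∉W (subst (w ∈_) (sym D≡V) (W⊆V w∈W)) w∈W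

  -- If a module N overlapped D, an edge inside D would cross N at some m, and
  -- exchanging m for an element of N ─ D would give an edge crossing D.
  component-strong : {D : Subset n} → IsComponentOf H x D → IsStrong H D
  component-strong {x} {D} comp@((closed , D⊆V , _) , _) = closed⇒module closed D⊆V , cmp
    where
    cmp : ∀ N → IsModule H N → Nonempty (D ∩ N) → D ⊆ N ⊎ N ⊆ D
    cmp N modN (c , c∈) with x∈p∩q⁻ D N c∈ | N ⊆? D
    ... | _ | yes N⊆D = inj₂ N⊆D
    ... | c∈D , c∈N | no N⊈D with ⊈⇒∃ N⊈D
    ...   | w , w∈N , w∉D with component-unsplittable comp unsplit
      where
      unsplit : ∀ e → E H e → e ⊆ D → Nonempty (e ∩ N) → e ⊆ N
      unsplit e Ee e⊆D (m , m∈) {o} o∈e = decidable-stable (o ∈? N) λ o∉N →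
        let m∈e , m∈N = x∈p∩q⁻ e N m∈
            _ , swaps = exchanges H modN Ee m∈e m∈N o∈e o∉N
            o∈e′ = ∈-exchange-old o∈e λ { refl → o∉N m∈N }
        in w∉D (closed _ (swaps w∈N) (o , x∈p∩q⁺ (o∈e′ , e⊆D o∈e)) (∈-exchange-new {e = e}))
    ...     | inj₁ D⊆N = inj₁ D⊆N
    ...     | inj₂ D∉N = contradiction c∈N (D∉N c∈D)

  -- An edge crossing X has its two other vertices in N; exchanging its vertex in X
  -- for one in X ─ N would give an edge crossing N in two vertices.
  covering⇒closed : IsUniform 3 H → IsModule H X → IsModule H N →
                    V H ⊆ X ∪ N → X ⊈ N → IsClosed H X
  covering⇒closed {X} {N} uniform modX modN V⊆ X⊈N e Ee (m , m∈) {o} o∈e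
    with x∈p∩q⁻ e X m∈ | ⊈⇒∃ X⊈N | ∣p∣≥3⇒other (ℕ.≤-reflexive (sym (uniform Ee))) m o
  ... | m∈e , m∈X | y , y∈X , y∉N | z , z∈e , z≢m , z≢o =
    decidable-stable (o ∈? X) λ o∉X →
      let unique , swaps = exchanges H modX Ee m∈e m∈X o∈e o∉X
          inN : ∀ {u} → u ∈ e → u ∉ X → u ∈ N
          inN u∈e u∉X = [ (λ u∈X → contradiction u∈X u∉X) , (λ u∈N → u∈N) ]′
                          (x∈p∪q⁻ X N (V⊆ (E⊆V H Ee u∈e)))
          o≢m : o ≢ m
          o≢m = λ { refl → o∉X m∈X }
          o∈N = inN o∈e o∉X
          z∈N = inN z∈e λ z∈X → z≢m (unique z∈e z∈X)
          unique′ , _ = exchanges H modN (swaps y∈X) (∈-exchange-old o∈e o≢m) o∈N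
                          (∈-exchange-new {e = e}) y∉N
      in z≢o (unique′ (∈-exchange-old z∈e z≢m) z∈N)

  -- Blocks of `Π H` and the quotient

  proper-strong⊆block : IsStrong H M → M ≢ V H → ∃[ B ] M ⊆ B × IsMaximalProperStrong H B
  proper-strong⊆block {M} strong M≢V =
    let B , M⊆B , proper , max =
          maximal (λ N → isStrong? H N ×-dec ¬? (N ≟ˢ V H)) M (strong , M≢V)
    in B , M⊆B , proper , λ N properN B⊆N → ⊆-antisym (max N properN B⊆N) B⊆N

  block-unique : IsMaximalProperStrong H M → IsMaximalProperStrong H N →
                 x ∈ M → x ∈ N → M ≡ N
  block-unique (PM , maxM) (PN , maxN) x∈M x∈N
    with strong-comparable H (proj₁ PM) (proj₁ (proj₁ PN)) x∈M x∈N
  ... | inj₁ M⊆N = sym (maxM _ PN M⊆N)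
  ... | inj₂ N⊆M = maxN _ PM N⊆M

  component⊆block : IsClosed H W → Nonempty W → W ⊆ V H → V H ⊈ W → x ∈ V H →
    ∃[ D ] ∃[ B ] IsComponentOf H x D × D ⊆ B × IsMaximalProperStrong H B
  component⊆block closed W≠∅ W⊆V V⊈W x∈V with component x∈V
  ... | D , comp with proper-strong⊆block (component-strong comp)
                        (component-proper comp closed W≠∅ W⊆V V⊈W)
  ...   | B , D⊆B , block = D , B , comp , D⊆B , block

  Π∋⇒block : M ∈ˡ Π H → IsMaximalProperStrong H M
  Π∋⇒block M∈ = proj₂ (∈-filter⁻ (isMaximalProperStrong? H) {xs = subsets n} M∈)

  block⇒∈Π : IsMaximalProperStrong H M → M ∈ˡ Π H
  block⇒∈Π {M} = ∈-filter⁺ (isMaximalProperStrong? H) (∈-subsets M)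

  -- Each edge lies in one component, hence meets only one block.
  disconnected⇒quotient-empty : IsClosed H W → Nonempty W → W ⊆ V H → V H ⊈ W →
    (P : List (Subset n)) → (∀ {B} → B ∈ˡ P → IsMaximalProperStrong H B) → Unique P →
    IsEmpty (H / P)
  disconnected⇒quotient-empty closed W≠∅ W⊆V V⊈W P block uniqueP 𝓔 (2≤ , e , Ee , 𝓔≡) =
    let i , j , i∈ , j∈ , i≢j = ∣p∣≥2⇒two 2≤
        a , a∈ = meets i∈
        b , b∈ = meets j∈
        a∈Bᵢ , a∈e = x∈p∩q⁻ (lookup P i) e a∈
        b∈Bⱼ , b∈e = x∈p∩q⁻ (lookup P j) e b∈
        D , B , ((closedD , _ , a∈D) , _) , D⊆B , blockB =
          component⊆block closed W≠∅ W⊆V V⊈W (E⊆V H Ee a∈e)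
        b∈D = closedD e Ee (a , x∈p∩q⁺ (a∈e , a∈D)) b∈e
    in i≢j (lookup-injective uniqueP i j
         (trans (block-unique (block (∈-lookup i)) blockB a∈Bᵢ (D⊆B a∈D))
                (block-unique blockB (block (∈-lookup j)) (D⊆B b∈D) b∈Bⱼ)))
    where
    meets : ∀ {i} → i ∈ 𝓔 → Nonempty (lookup P i ∩ e)
    meets i∈ = Equivalence.to (∈-comprehension (λ i → nonempty? (lookup P i ∩ e)))
                 (subst (_ ∈_) 𝓔≡ i∈)

-- The closure of a module that is not strong

module _ (H : Hypergraph n) (uniform : IsUniform 3 H) {M Z : Subset n}
         (modM : IsModule H M) (M≠∅ : Nonempty M) (¬strongM : ¬ IsStrong H M)
         (strongZ : IsStrong H Z) (M⊆Z : M ⊆ Z)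
         (least : ∀ {N} → IsStrong H N → M ⊆ N → Z ⊆ N) where

  private
    Z⊈M : Z ⊈ M
    Z⊈M Z⊆M = ¬strongM (subst (IsStrong H) (⊆-antisym Z⊆M M⊆Z) strongZ)

  -- A maximal module X with M ⊆ X ⊊ Z is not strong, and any module overlapping
  -- it covers, together with X, all of Z.
  disconnected : ∃[ X ] IsClosed (H [ Z ]) X × M ⊆ X × X ⊆ Z × Z ⊈ X
  disconnected = from-maximal
    (maximal (λ X → isModule? H X ×-dec M ⊆? X ×-dec X ⊆? Z ×-dec ¬? (Z ⊆? X)) M
      (modM , (λ x∈ → x∈) , M⊆Z , Z⊈M))
    where
    Between : Pred (Subset n) 0ℓ
    Between X = IsModule H X × M ⊆ X × X ⊆ Z × Z ⊈ X

    from-maximal : ∃[ X ] M ⊆ X × IsMaximal Between X →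
                   ∃[ X ] IsClosed (H [ Z ]) X × M ⊆ X × X ⊆ Z × Z ⊈ X
    from-maximal (X , _ , (modX , M⊆X , X⊆Z , Z⊈X) , max)
      with ¬strong⇒overlap H modX (λ strongX → Z⊈X (least strongX M⊆X))
    ... | N , modN , (c , c∈) , X⊈N , N⊈X with x∈p∩q⁻ X N c∈
    ...   | c∈X , c∈N with strong-comparable H strongZ modN (X⊆Z c∈X) c∈N
    ...     | inj₁ Z⊆N = ⊥-elim (X⊈N λ x∈X → Z⊆N (X⊆Z x∈X))
    ...     | inj₂ N⊆Z = X , closed , M⊆X , X⊆Z , Z⊈X
      where
      X∪N⊆Z : X ∪ N ⊆ Z
      X∪N⊆Z x∈ = [ X⊆Z , N⊆Z ]′ (x∈p∪q⁻ X N x∈)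

      Z⊆X∪N : Z ⊆ X ∪ N
      -- Otherwise the module `X ∪ N` would itself lie between `M` and `Z`, and maximality of `X`
      -- would force `N ⊆ X`.
      Z⊆X∪N = decidable-stable (Z ⊆? X ∪ N) λ Z⊈X∪N → N⊈X λ x∈N →
        max (X ∪ N)
          (∪-module H modX modN c∈X c∈N , (λ x∈M → x∈p∪q⁺ (inj₁ (M⊆X x∈M))) , X∪N⊆Z , Z⊈X∪N)
          (p⊆p∪q N) (q⊆p∪q X N x∈N)

      closed : IsClosed (H [ Z ]) X
      closed = covering⇒closed (H [ Z ]) (uniform ∘ proj₁)
                 (module-[]⁺ H modX X⊆Z) (module-[]⁺ H modN N⊆Z) Z⊆X∪N X⊈N

  quotient-empty : IsEmpty (H [ Z ] / Π (H [ Z ]))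
  quotient-empty =
    let X , closed , M⊆X , X⊆Z , Z⊈X = disconnected
    in disconnected⇒quotient-empty (H [ Z ]) closed (proj₁ M≠∅ , M⊆X (proj₂ M≠∅)) X⊆Z Z⊈X
         (Π (H [ Z ])) (Π∋⇒block (H [ Z ])) (filter⁺ (isMaximalProperStrong? (H [ Z ])) (subsets-unique n))

  private
    block∋ : x ∈ Z → ∃[ B ] x ∈ B × IsMaximalProperStrong (H [ Z ]) B
    block∋ x∈Z =
      let X , closed , M⊆X , X⊆Z , Z⊈X = disconnected
          D , B , ((_ , _ , x∈D) , _) , D⊆B , block =
            component⊆block (H [ Z ]) closed (proj₁ M≠∅ , M⊆X (proj₂ M≠∅)) X⊆Z Z⊈X x∈Z
      in B , D⊆B x∈D , block

    -- A block is strong in `H` too, hence comparable with `M`; if it contained `M` it would contain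
    -- `Z`, by `least`.
    block-meeting-M : {B : Subset n} → IsMaximalProperStrong (H [ Z ]) B → x ∈ M → x ∈ B → M ⊈ B × B ⊆ M
    block-meeting-M {B = B} ((strongB , B≢Z) , _) x∈M x∈B =
      M⊈B , compare (strong-comparable H strongB′ modM x∈B x∈M)
      where
      strongB′ : IsStrong H B
      strongB′ = strong-[]⁻ H strongZ strongB

      M⊈B : M ⊈ B
      M⊈B M⊆B = B≢Z (⊆-antisym (proj₁ (proj₁ strongB)) (least strongB′ M⊆B))

      compare : B ⊆ M ⊎ M ⊆ B → B ⊆ M
      compare (inj₁ B⊆M) = B⊆M
      compare (inj₂ M⊆B) = ⊥-elim (M⊈B M⊆B)

  -- M is a union of at least two blocks, and misses one.
  ∣Π∣≥3 : length (Π (H [ Z ])) ≥ 3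
  ∣Π∣≥3 =
    let x , x∈M = M≠∅
        z , z∈Z , z∉M = ⊈⇒∃ Z⊈M
        B , x∈B , block = block∋ (M⊆Z x∈M)
        M⊈B , B⊆M = block-meeting-M block x∈M x∈B
        y , y∈M , y∉B = ⊈⇒∃ M⊈B
        B′ , y∈B′ , block′ = block∋ (M⊆Z y∈M)
        _ , B′⊆M = block-meeting-M block′ y∈M y∈B′
        B″ , z∈B″ , block″ = block∋ z∈Z
    in three∈⇒length≥3 (block⇒∈Π (H [ Z ]) block) (block⇒∈Π (H [ Z ]) block′) (block⇒∈Π (H [ Z ]) block″)
         (λ B≡B′ → y∉B (subst (y ∈_) (sym B≡B′) y∈B′))
         (λ B≡B″ → z∉M (B⊆M (subst (z ∈_) (sym B≡B″) z∈B″)))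
         (λ B′≡B″ → z∉M (B′⊆M (subst (z ∈_) (sym B′≡B″) z∈B″)))

-- Tournaments

triple : Fin n → Fin n → Fin n → Subset n
triple a b c = ⁅ a ⁆ ∪ ⁅ b ⁆ ∪ ⁅ c ⁆

module _ {a b c : Fin n} where

  1st∈triple : a ∈ triple a b c
  1st∈triple = x∈p∪q⁺ (inj₁ (x∈⁅x⁆ a))

  2nd∈triple : b ∈ triple a b c
  2nd∈triple = x∈p∪q⁺ {p = ⁅ a ⁆} (inj₂ (x∈p∪q⁺ (inj₁ (x∈⁅x⁆ b))))

  3rd∈triple : c ∈ triple a b c
  3rd∈triple = x∈p∪q⁺ {p = ⁅ a ⁆} (inj₂ (x∈p∪q⁺ {p = ⁅ b ⁆} (inj₂ (x∈⁅x⁆ c))))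

  ∈-triple⁻ : x ∈ triple a b c → x ≡ a ⊎ x ≡ b ⊎ x ≡ c
  ∈-triple⁻ x∈ with x∈p∪q⁻ ⁅ a ⁆ _ x∈
  ... | inj₁ x∈a = inj₁ (x∈⁅y⁆⇒x≡y a x∈a)
  ... | inj₂ x∈bc with x∈p∪q⁻ ⁅ b ⁆ _ x∈bc
  ...   | inj₁ x∈b = inj₂ (inj₁ (x∈⁅y⁆⇒x≡y b x∈b))
  ...   | inj₂ x∈c = inj₂ (inj₂ (x∈⁅y⁆⇒x≡y c x∈c))

  triple-⊆ : a ∈ p → b ∈ p → c ∈ p → triple a b c ⊆ p
  triple-⊆ a∈ b∈ c∈ x∈ with ∈-triple⁻ x∈
  ... | inj₁ refl = a∈
  ... | inj₂ (inj₁ refl) = b∈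
  ... | inj₂ (inj₂ refl) = c∈

  ∣triple∣≡3 : a ≢ b → a ≢ c → b ≢ c → ∣ triple a b c ∣ ≡ 3
  ∣triple∣≡3 a≢b a≢c b≢c =
    trans (∣⁅x⁆∪p∣≡1+∣p∣ λ a∈ → [ a≢b ∘ x∈⁅y⁆⇒x≡y b , a≢c ∘ x∈⁅y⁆⇒x≡y c ]′
                                  (x∈p∪q⁻ ⁅ b ⁆ ⁅ c ⁆ a∈))
      (cong suc (trans (∣⁅x⁆∪p∣≡1+∣p∣ (x≢y⇒x∉⁅y⁆ b≢c)) (cong suc (∣⁅x⁆∣≡1 c))))

triple-rotate : (a b c : Fin n) → triple a b c ≡ triple b c a
triple-rotate a b c = ⊆-antisym
  (triple-⊆ {a = a} {b} {c} (3rd∈triple {a = b} {c} {a}) (1st∈triple {a = b} {c} {a}) (2nd∈triple {a = b} {c} {a}))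
  (triple-⊆ {a = b} {c} {a} (2nd∈triple {a = a} {b} {c}) (3rd∈triple {a = a} {b} {c}) (1st∈triple {a = a} {b} {c}))

exchange-triple : (a b c k : Fin n) → a ≢ b → a ≢ c → exchange (triple a b c) a k ≡ triple k b c
exchange-triple a b c k a≢b a≢c = ⊆-antisym to
  (triple-⊆ {a = k} {b} {c} (∈-exchange-new {e = triple a b c})
    (∈-exchange-old (2nd∈triple {a = a} {b} {c}) (a≢b ∘ sym))
    (∈-exchange-old (3rd∈triple {a = a} {b} {c}) (a≢c ∘ sym)))
  where
  to : exchange (triple a b c) a k ⊆ triple k b c
  to {x} x∈ with ∈-exchange⁻ {x = x} {e = triple a b c} {m = a} x∈
  ... | inj₂ refl = 1st∈triple {a = k} {b} {c}
  ... | inj₁ (x∈abc , x≢a) with ∈-triple⁻ {a = a} {b} {c} x∈abc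
  ...   | inj₁ x≡a = contradiction x≡a x≢a
  ...   | inj₂ (inj₁ refl) = 2nd∈triple {a = k} {b} {c}
  ...   | inj₂ (inj₂ refl) = 3rd∈triple {a = k} {b} {c}

-- Arcs, and the vertices that split a set

module _ (T : Tournament n) where

  Cyclic : Fin n → Fin n → Fin n → Set
  Cyclic a b c = A T a b × A T b c × A T c a

  rotate : {a b c : Fin n} → Cyclic a b c → Cyclic b c a
  rotate (ab , bc , ca) = bc , ca , ab

  arc⇒≢ : A T x y → x ≢ y
  arc⇒≢ xx refl = irrefl T xx

  arc-total : x ∈ Vₜ T → y ∈ Vₜ T → x ≢ y → A T x y ⊎ A T y x
  arc-total x∈ y∈ x≢y = [ inj₁ ∘ proj₁ , inj₂ ∘ proj₂ ]′ (exactlyOne T x∈ y∈ x≢y)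

  ¬arc⇒arc : x ∈ Vₜ T → y ∈ Vₜ T → x ≢ y → ¬ A T x y → A T y x
  ¬arc⇒arc x∈ y∈ x≢y ¬xy = [ (λ xy → contradiction xy ¬xy) , (λ yx → yx) ]′ (arc-total x∈ y∈ x≢y)

  -- For `M ⊆ Vₜ T` this is membership in `S T M`, with the two arcs that witness it made explicit.
  Splits : Subset n → Fin n → Set
  Splits M v = v ∉ M × ∃[ x ] ∃[ y ] x ∈ M × y ∈ M × A T x v × A T v y

  ¬module⇒split : M ⊆ Vₜ T → ¬ IsTournamentModule T M → ∃[ v ] Splits M v
  ¬module⇒split {M} M⊆V ¬mod
    with any? (λ v → ¬? (v ∈? M) ×-dec any? λ x → any? λ y →
                x ∈? M ×-dec y ∈? M ×-dec A? T x v ×-dec A? T v y)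
  ... | yes split = split
  ... | no none = ⊥-elim (¬mod (M⊆V , λ x y v x∈ y∈ _ xv vy →
          decidable-stable (v ∈? M) λ v∉M → none (v , v∉M , x , y , x∈ , y∈ , xv , vy)))

  InS : Subset n → Pred (Fin n) 0ℓ
  InS M v = v ∈ Vₜ T × v ∉ M × ¬ IsTournamentModule (T ⟦ M ∪ ⁅ v ⁆ ⟧) M

  InS? : (M : Subset n) → Decidable (InS M)
  InS? M v = v ∈? Vₜ T ×-dec ¬? (v ∈? M) ×-dec ¬? (isTournamentModule? (T ⟦ M ∪ ⁅ v ⁆ ⟧) M)

  split⇒∈S : {v : Fin n} → Splits M v → v ∈ S T M
  split⇒∈S {M} {v} (v∉M , x , y , x∈ , y∈ , xv , vy) =
    Equivalence.from (∈-comprehension (InS? M))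
      (proj₁ (A⊆V×V T vy) , v∉M , λ (_ , convex) → v∉M
        (convex x y v x∈ y∈ (x∈p∩q⁺ (proj₁ (A⊆V×V T vy) , v∈)) (xv , M⊆ x∈ , v∈) (vy , v∈ , M⊆ y∈)))
    where
    M⊆ : M ⊆ M ∪ ⁅ v ⁆
    M⊆ = p⊆p∪q ⁅ v ⁆

    v∈ : v ∈ M ∪ ⁅ v ⁆
    v∈ = q⊆p∪q M ⁅ v ⁆ (x∈⁅x⁆ v)

module _ (T : Tournament n) where

  ∈S⇒split : {v : Fin n} → M ⊆ Vₜ T → v ∈ S T M → Splits T M v
  ∈S⇒split {M} {v} M⊆V v∈S =
    let v∈V , v∉M , ¬mod = Equivalence.to (∈-comprehension (InS? T M)) v∈S
        w , w∉M , x , y , x∈ , y∈ , (xw , _ , w∈) , (wy , _) =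
          ¬module⇒split (T ⟦ M ∪ ⁅ v ⁆ ⟧) (λ u∈ → x∈p∩q⁺ (M⊆V u∈ , p⊆p∪q ⁅ v ⁆ u∈)) ¬mod
        -- The only vertex of `T ⟦ M ∪ ⁅ v ⁆ ⟧` outside `M` is `v`.
        w≡v = [ (λ w∈M → contradiction w∈M w∉M) , x∈⁅y⁆⇒x≡y v ]′ (x∈p∪q⁻ M ⁅ v ⁆ w∈)
    in v∉M , x , y , x∈ , y∈ , subst (A T x) w≡v xw , subst (λ u → A T u y) w≡v wy

-- 3-cycles of a realization as edges

module _ {T : Tournament n} {H : Hypergraph n} (real : T IsRealizationOf H) where

  cyclic⇒edge : {a b c : Fin n} → Cyclic T a b c → E H (triple a b c)
  cyclic⇒edge {a} {b} {c} (ab , bc , ca) = proj₂ (proj₂ real)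
    ( triple-⊆ {a = a} {b} {c} (proj₁ (A⊆V×V T ab)) (proj₁ (A⊆V×V T bc)) (proj₁ (A⊆V×V T ca))
    , ∣triple∣≡3 (arc⇒≢ T ab) (arc⇒≢ T ca ∘ sym) (arc⇒≢ T bc)
    , Equivalence.to (is3Cycle⇔ (T ⟦ triple a b c ⟧))
        ( a , b , c , p∩q⊆q (Vₜ T) (triple a b c)
        , (ab , a∈ , b∈) , (bc , b∈ , c∈) , (ca , c∈ , a∈)) )
    where
    a∈ = 1st∈triple {a = a} {b} {c}
    b∈ = 2nd∈triple {a = a} {b} {c}
    c∈ = 3rd∈triple {a = a} {b} {c}

  -- The 3-cycle is rotated to start at the prescribed vertex `m`.
  edge⇒cyclic : E H e → m ∈ e → ∃[ b ] ∃[ c ] Cyclic T m b c × e ≡ triple m b c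
  edge⇒cyclic {e} {m} Ee m∈e =
    let e⊆V , _ , cycle = proj₁ (proj₂ real) Ee
        a , b , c , V⊆ , (ab , a∈ , b∈) , (bc , _ , c∈) , (ca , _) =
          Equivalence.from (is3Cycle⇔ (T ⟦ e ⟧)) cycle
        e≡ = ⊆-antisym (λ x∈e → V⊆ (x∈p∩q⁺ (e⊆V x∈e , x∈e))) (triple-⊆ {a = a} {b} {c} a∈ b∈ c∈)
    in rotated (ab , bc , ca) e≡ (∈-triple⁻ {a = a} {b} {c} (subst (m ∈_) e≡ m∈e))
    where
    rotated : {a b c : Fin n} → Cyclic T a b c → e ≡ triple a b c → m ≡ a ⊎ m ≡ b ⊎ m ≡ c →
              ∃[ b ] ∃[ c ] Cyclic T m b c × e ≡ triple m b c
    rotated {a} {b} {c} abc e≡ (inj₁ refl) = b , c , abc , e≡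
    rotated {a} {b} {c} abc e≡ (inj₂ (inj₁ refl)) =
      c , a , rotate T abc , trans e≡ (triple-rotate a b c)
    rotated {a} {b} {c} abc e≡ (inj₂ (inj₂ refl)) =
      a , b , rotate T (rotate T abc) ,
      trans e≡ (trans (triple-rotate a b c) (triple-rotate b c a))

  Vₜ≡ : V H ≡ Vₜ T
  Vₜ≡ = proj₁ real

  -- Two vertices of a 3-cycle in `M` pull in the third, so a cycle crossing `M` meets it once. Its
  -- other two vertices each have the same direction towards all of `M`, hence any vertex of `M` can
  -- replace `m`.
  tournament-module⇒module : IsTournamentModule T M → IsModule H M
  tournament-module⇒module {M} (M⊆V , convex) =
    exchanges⇒module H (subst (M ⊆_) (sym Vₜ≡) M⊆V) exch
    where
    exch : Exchanges H M
    exch {e} {m} {o} Ee m∈e m∈M o∈e o∉M with edge⇒cyclic Ee m∈e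
    ... | b , c , mbc@(mb , bc , cm) , refl = unique , swaps
      where
      ∈M⇒ : ∀ {x y w} → x ∈ M → y ∈ M → A T x w → A T w y → w ∈ M
      ∈M⇒ x∈ y∈ xw wy = convex _ _ _ x∈ y∈ (proj₂ (A⊆V×V T xw)) xw wy

      b⇒c : b ∈ M → c ∈ M
      b⇒c b∈M = ∈M⇒ b∈M m∈M bc cm

      c⇒b : c ∈ M → b ∈ M
      c⇒b c∈M = ∈M⇒ m∈M c∈M mb bc

      not-both : b ∈ M → c ∈ M → ⊥
      not-both b∈M c∈M = o∉M (triple-⊆ {a = m} {b} {c} m∈M b∈M c∈M o∈e)

      b∉M : b ∉ M
      b∉M b∈M = not-both b∈M (b⇒c b∈M)

      c∉M : c ∉ M
      c∉M c∈M = not-both (c⇒b c∈M) c∈M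

      unique : ∀ {x} → x ∈ triple m b c → x ∈ M → x ≡ m
      unique x∈ x∈M with ∈-triple⁻ {a = m} {b} {c} x∈
      ... | inj₁ x≡m = x≡m
      ... | inj₂ (inj₁ refl) = contradiction x∈M b∉M
      ... | inj₂ (inj₂ refl) = contradiction x∈M c∉M

      swaps : ∀ {k} → k ∈ M → E H (exchange (triple m b c) m k)
      swaps {k} k∈M = subst (E H) (sym (exchange-triple m b c k (arc⇒≢ T mb) (arc⇒≢ T cm ∘ sym)))
        (cyclic⇒edge (kb , bc , ck))
        where
        kb : A T k b
        kb = ¬arc⇒arc T (proj₁ (A⊆V×V T bc)) (M⊆V k∈M) (λ { refl → b∉M k∈M })
               λ bk → b∉M (∈M⇒ m∈M k∈M mb bk)

        ck : A T c k
        ck = ¬arc⇒arc T (M⊆V k∈M) (proj₁ (A⊆V×V T cm)) (λ { refl → c∉M k∈M })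
               λ kc → c∉M (∈M⇒ k∈M m∈M kc cm)

  -- A module of the hypergraph inside the tournament

  module _ {M : Subset n} (modM : IsModule H M) where

    private
      M⊆V : M ⊆ Vₜ T
      M⊆V = subst (M ⊆_) Vₜ≡ (proj₁ modM)

    -- An edge leaving `M` meets it in at most one vertex, but `a` and `b` are distinct.
    cyclic-absorb : {a b c : Fin n} → Cyclic T a b c → a ∈ M → b ∈ M → c ∈ M
    cyclic-absorb {a} {b} {c} abc a∈M b∈M = decidable-stable (c ∈? M) λ c∉M →
      arc⇒≢ T (proj₁ abc) (sym (proj₁ (exchanges H modM (cyclic⇒edge abc)
        (1st∈triple {a = a} {b} {c}) a∈M (3rd∈triple {a = a} {b} {c}) c∉M)
        (2nd∈triple {a = a} {b} {c}) b∈M))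

    -- Exchange in `H` yields a 3-cycle on `k`, `b`, `c` of unknown orientation; the arc from `b` to
    -- `c` is untouched and settles it.
    cyclic-exchange : {a b c k : Fin n} → Cyclic T a b c → a ∈ M → b ∉ M → c ∉ M → k ∈ M →
                      Cyclic T k b c
    cyclic-exchange {a} {b} {c} {k} abc@(ab , bc , ca) a∈M b∉M c∉M k∈M =
      orient (∈-triple⁻ {a = k} {b′} {c′} (subst (b ∈_) ≡kb′c′ (2nd∈triple {a = k} {b} {c})))
             (∈-triple⁻ {a = k} {b′} {c′} (subst (c ∈_) ≡kb′c′ (3rd∈triple {a = k} {b} {c})))
      where
      swapped : E H (triple k b c)
      swapped = subst (E H) (exchange-triple a b c k (arc⇒≢ T ab) (arc⇒≢ T ca ∘ sym))
        (proj₂ (exchanges H modM (cyclic⇒edge abc)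
          (1st∈triple {a = a} {b} {c}) a∈M (2nd∈triple {a = a} {b} {c}) b∉M) k∈M)

      cycle = edge⇒cyclic swapped (1st∈triple {a = k} {b} {c})
      b′ = proj₁ cycle
      c′ = proj₁ (proj₂ cycle)
      kb′c′ = proj₁ (proj₂ (proj₂ cycle))
      ≡kb′c′ = proj₂ (proj₂ (proj₂ cycle))

      orient : b ≡ k ⊎ b ≡ b′ ⊎ b ≡ c′ → c ≡ k ⊎ c ≡ b′ ⊎ c ≡ c′ → Cyclic T k b c
      orient (inj₁ b≡k) _ = contradiction (subst (_∈ M) (sym b≡k) k∈M) b∉M
      orient _ (inj₁ c≡k) = contradiction (subst (_∈ M) (sym c≡k) k∈M) c∉M
      orient (inj₂ (inj₁ b≡)) (inj₂ (inj₂ c≡)) = subst₂ (Cyclic T k) (sym b≡) (sym c≡) kb′c′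
      orient (inj₂ (inj₂ b≡)) (inj₂ (inj₁ c≡)) =
        contradiction (subst₂ (A T) (sym c≡) (sym b≡) (proj₁ (proj₂ kb′c′))) (asym T bc)
      orient (inj₂ (inj₁ b≡)) (inj₂ (inj₁ c≡)) = contradiction (trans b≡ (sym c≡)) (arc⇒≢ T bc)
      orient (inj₂ (inj₂ b≡)) (inj₂ (inj₂ c≡)) = contradiction (trans b≡ (sym c≡)) (arc⇒≢ T bc)

    private
      U : Subset n
      U = M ∪ S T M

      split : {v : Fin n} → v ∈ S T M → Splits T M v
      split = ∈S⇒split T M⊆V

    U⊆V : U ⊆ Vₜ T
    U⊆V u∈ with x∈p∪q⁻ M (S T M) u∈
    ... | inj₁ u∈M = M⊆V u∈M
    ... | inj₂ u∈S = let _ , _ , _ , _ , _ , xu , _ = split u∈S in proj₂ (A⊆V×V T xu)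

    -- If M → w and w → u with x → u → y and x , y ∈ M, then u → y → w → u is a 3-cycle
    -- meeting M in y alone, but exchanging y for x does not give a 3-cycle.
    dominates : {w u : Fin n} → w ∉ U → m ∈ M → A T m w → u ∈ U → A T u w
    dominates {m} {w} {u} w∉U m∈M mw u∈U =
      ¬arc⇒arc T w∈V (U⊆V u∈U) (λ { refl → w∉U u∈U })
        λ wu → [ (λ u∈M → w∉U (absorbed u∈M wu)) , (λ u∈S → impossible u∈S wu) ]′
                 (x∈p∪q⁻ M (S T M) u∈U)
      where
      w∈V : w ∈ Vₜ T
      w∈V = proj₂ (A⊆V×V T mw)

      w∉M : w ∉ M
      w∉M = w∉U ∘ x∈p∪q⁺ ∘ inj₁

      absorbed : {y : Fin n} → y ∈ M → A T w y → w ∈ U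
      absorbed y∈M wy = q⊆p∪q M (S T M) (split⇒∈S T (w∉M , _ , _ , m∈M , y∈M , mw , wy))

      impossible : u ∈ S T M → ¬ A T w u
      impossible u∈S wu =
        let u∉M , x , y , x∈M , y∈M , xu , uy = split u∈S
            yw = ¬arc⇒arc T w∈V (M⊆V y∈M) (λ { refl → w∉M y∈M }) (w∉U ∘ absorbed y∈M)
            _ , _ , ux = cyclic-exchange (yw , wu , uy) y∈M w∉M u∉M x∈M
        in asym T xu ux

    -- The dual of `dominates`: the 3-cycle is now x → u → w → x, and exchanging x for y would
    -- reverse u → y.
    dominated : {w u : Fin n} → w ∉ U → m ∈ M → A T w m → u ∈ U → A T w u
    dominated {m} {w} {u} w∉U m∈M wm u∈U =
      ¬arc⇒arc T (U⊆V u∈U) w∈V (λ { refl → w∉U u∈U })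
        λ uw → [ (λ u∈M → w∉U (absorbed u∈M uw)) , (λ u∈S → impossible u∈S uw) ]′
                 (x∈p∪q⁻ M (S T M) u∈U)
      where
      w∈V : w ∈ Vₜ T
      w∈V = proj₁ (A⊆V×V T wm)

      w∉M : w ∉ M
      w∉M = w∉U ∘ x∈p∪q⁺ ∘ inj₁

      absorbed : {x : Fin n} → x ∈ M → A T x w → w ∈ U
      absorbed x∈M xw = q⊆p∪q M (S T M) (split⇒∈S T (w∉M , _ , _ , x∈M , m∈M , xw , wm))

      impossible : u ∈ S T M → ¬ A T u w
      impossible u∈S uw =
        let u∉M , x , y , x∈M , y∈M , xu , uy = split u∈S
            wx = ¬arc⇒arc T (M⊆V x∈M) w∈V (λ { refl → w∉M x∈M }) (w∉U ∘ absorbed x∈M)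
            yu , _ = cyclic-exchange (xu , uw , wx) x∈M u∉M w∉M y∈M
        in asym T uy yu

    -- The arc between `w` and a single vertex of `M` fixes the direction between `w` and all of
    -- `U`.
    M∪S-module : Nonempty M → IsTournamentModule T U
    M∪S-module (m , m∈M) = U⊆V , λ x y w x∈U y∈U w∈V xw wy →
      decidable-stable (w ∈? U) λ w∉U →
        [ (λ mw → asym T wy (dominates w∉U m∈M mw y∈U))
        , (λ wm → asym T xw (dominated w∉U m∈M wm x∈U)) ]′
          (arc-total T (M⊆V m∈M) w∈V λ { refl → w∉U (p⊆p∪q (S T M) m∈M) })

    private
      K : Hypergraph n
      K = H [ U ]

    -- A 3-cycle with just one vertex in M would by exchange survive for every
    -- vertex of M, so that its two other vertices could not split M.
    M-closed : IsClosed K M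
    M-closed e (Ee , e⊆U) (m , m∈) with x∈p∩q⁻ e M m∈
    ... | m∈e , m∈M with edge⇒cyclic Ee m∈e
    ...   | b , c , mbc , refl = triple-⊆ {a = m} {b} {c} m∈M b∈M c∈M
      where
      ∉M⇒∈S : ∀ {u} → u ∈ triple m b c → u ∉ M → u ∈ S T M
      ∉M⇒∈S u∈ u∉M = [ ⊥-elim ∘ u∉M , (λ u∈S → u∈S) ]′ (x∈p∪q⁻ M (S T M) (e⊆U u∈))

      b∈M : b ∈ M
      b∈M = decidable-stable (b ∈? M) λ b∉M →
        let c∉M = λ c∈M → b∉M (cyclic-absorb (rotate T (rotate T mbc)) c∈M m∈M)
            _ , x , y , x∈M , y∈M , xb , by = split (∉M⇒∈S (2nd∈triple {a = m} {b} {c}) b∉M)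
        in asym T by (proj₁ (cyclic-exchange mbc m∈M b∉M c∉M y∈M))

      c∈M : c ∈ M
      c∈M = cyclic-absorb mbc m∈M b∈M

    module _ {v : Fin n} (v∈S : v ∈ S T M) where

      private
        N? : Decidable (λ u → u ∈ S T M ⊎ (u ∈ M × A T v u))
        N? u = u ∈? S T M ⊎-dec (u ∈? M ×-dec A? T v u)

      -- A module of H that overlaps M and contains S.
      upper : Subset n
      upper = comprehension N?

      ∈-upper⁺ : u ∈ S T M ⊎ (u ∈ M × A T v u) → u ∈ upper
      ∈-upper⁺ = Equivalence.from (∈-comprehension N?)

      ∈-upper⁻ : u ∈ upper → u ∈ S T M ⊎ (u ∈ M × A T v u)
      ∈-upper⁻ = Equivalence.to (∈-comprehension N?)

      private
        v∉M : v ∉ M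
        v∉M = proj₁ (split v∈S)

        v∈V : v ∈ Vₜ T
        v∈V = let _ , _ , _ , _ , _ , xv , _ = split v∈S in proj₂ (A⊆V×V T xv)

        -- Otherwise a → b → v → a would be a 3-cycle with exactly two vertices in `M`.
        v→-step : {a b : Fin n} → a ∈ M → b ∈ M → A T v a → A T a b → A T v b
        v→-step a∈M b∈M va ab = ¬arc⇒arc T (M⊆V b∈M) v∈V (λ { refl → v∉M b∈M })
          λ bv → v∉M (cyclic-absorb (ab , bv , va) a∈M b∈M)

      -- By `M-closed` an edge through a vertex of `S T M` stays in `S T M`. An edge through an
      -- out-neighbour of `v` in `M` stays in `M`, and `v→-step` carries the arc from `v` around the
      -- cycle.
      upper-closed : IsClosed K upper
      upper-closed e (Ee , e⊆U) (m , m∈) {o} o∈e with x∈p∩q⁻ e upper m∈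
      ... | m∈e , m∈upper with ∈-upper⁻ m∈upper
      ...   | inj₁ m∈S = ∈-upper⁺ (inj₁ ([ (λ o∈M → contradiction
                (M-closed e (Ee , e⊆U) (o , x∈p∩q⁺ (o∈e , o∈M)) m∈e) (proj₁ (split m∈S)))
                , (λ o∈S → o∈S) ]′ (x∈p∪q⁻ M (S T M) (e⊆U o∈e))))
      ...   | inj₂ (m∈M , vm) with M-closed e (Ee , e⊆U) (m , x∈p∩q⁺ (m∈e , m∈M)) | edge⇒cyclic Ee m∈e
      ...     | e⊆M | b , c , (mb , bc , cm) , refl =
        ∈-upper⁺ (inj₂ (e⊆M o∈e , v→o (∈-triple⁻ {a = m} {b} {c} o∈e)))
        where
        b∈M = e⊆M (2nd∈triple {a = m} {b} {c})
        c∈M = e⊆M (3rd∈triple {a = m} {b} {c})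

        vb : A T v b
        vb = v→-step m∈M b∈M vm mb

        v→o : o ≡ m ⊎ o ≡ b ⊎ o ≡ c → A T v o
        v→o (inj₁ refl) = vm
        v→o (inj₂ (inj₁ refl)) = vb
        v→o (inj₂ (inj₂ refl)) = v→-step b∈M c∈M vb bc

      -- Closed sets are modules of `K`, and these are modules of `H` because `U`, a module of `T`,
      -- is one of `H`.
      upper-module : IsModule H upper
      upper-module = module-[]⁻ H
        (tournament-module⇒module (M∪S-module M≠∅))
        (closed⇒module K upper-closed upper⊆U)
        where
        M≠∅ : Nonempty M
        M≠∅ = let _ , x , _ , x∈M , _ = split v∈S in x , x∈M

        upper⊆U : upper ⊆ U
        upper⊆U u∈ = [ q⊆p∪q M (S T M) , p⊆p∪q (S T M) ∘ proj₁ ]′ (∈-upper⁻ u∈)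

      -- An out-neighbour `y` of `v` in `M` makes `N` and `upper` comparable; an in-neighbour `x` in
      -- `M` lies outside `upper` and rules out `N ⊆ upper`.
      strong⊇M⇒⊇upper : IsStrong H N → M ⊆ N → upper ⊆ N
      strong⊇M⇒⊇upper {N} strongN M⊆N =
        let _ , x , y , x∈M , y∈M , xv , vy = split v∈S
        in compare x∈M xv (strong-comparable H strongN upper-module (M⊆N y∈M) (∈-upper⁺ (inj₂ (y∈M , vy))))
        where
        compare : x ∈ M → A T x v → N ⊆ upper ⊎ upper ⊆ N → upper ⊆ N
        compare _ _ (inj₂ upper⊆N) = upper⊆N
        compare x∈M xv (inj₁ N⊆upper) with ∈-upper⁻ (N⊆upper (M⊆N x∈M))
        ... | inj₁ x∈S = contradiction x∈M (proj₁ (split x∈S))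
        ... | inj₂ (_ , vx) = contradiction vx (asym T xv)

      S⊆upper : S T M ⊆ upper
      S⊆upper = ∈-upper⁺ ∘ inj₁

    split⇒¬strong : {v : Fin n} → v ∈ S T M → ¬ IsStrong H M
    split⇒¬strong v∈S strongM =
      proj₁ (split v∈S) (strong⊇M⇒⊇upper v∈S strongM (λ x∈ → x∈) (S⊆upper v∈S v∈S))

proposition46 : (n : ℕ) (H : Hypergraph n) → IsUniform 3 H → Realizable H →
    (T : Tournament n) → T IsRealizationOf H →
    (M : Subset n) → IsModule H M → ¬ IsTournamentModule T M →
    IsTournamentModule T (M ∪ S T M)
    × (¬ IsStrong H M)
    × (M ∪ S T M ⊆ strongClosure H M)
    × (let K = H [ strongClosure H M ] in IsEmpty (K / Π K) × length (Π K) ≥ 3)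
proposition46 n H uniform _ T real M modM ¬modT =
  M∪S-module {T = T} {H} real modM M≠∅ ,
  ¬strongM ,
  M∪S⊆M̃ ,
  quotient-empty H uniform {M} {strongClosure H M} modM M≠∅ ¬strongM strongM̃ M⊆M̃ least ,
  ∣Π∣≥3 H uniform {M} {strongClosure H M} modM M≠∅ ¬strongM strongM̃ M⊆M̃ least
  where
  M⊆V : M ⊆ Vₜ T
  M⊆V = subst (M ⊆_) (proj₁ real) (proj₁ modM)

  splitter : ∃[ v ] Splits T M v
  splitter = ¬module⇒split T M⊆V ¬modT

  v∈S : proj₁ splitter ∈ S T M
  v∈S = split⇒∈S T (proj₂ splitter)

  -- A splitting vertex has an in-neighbour in `M`.
  M≠∅ : Nonempty M
  M≠∅ = let _ , _ , x , _ , x∈M , _ = splitter in x , x∈M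

  ¬strongM : ¬ IsStrong H M
  ¬strongM = split⇒¬strong {T = T} {H} real modM v∈S

  strongM̃ : IsStrong H (strongClosure H M)
  strongM̃ = proj₁ (strongClosure-strong H M≠∅ (proj₁ modM))

  M⊆M̃ : M ⊆ strongClosure H M
  M⊆M̃ = proj₂ (strongClosure-strong H M≠∅ (proj₁ modM))

  least : {N : Subset n} → IsStrong H N → M ⊆ N → strongClosure H M ⊆ N
  least = strongClosure-least H

  M∪S⊆M̃ : M ∪ S T M ⊆ strongClosure H M
  M∪S⊆M̃ {x} x∈ with x∈p∪q⁻ M (S T M) x∈
  ... | inj₁ x∈M = M⊆M̃ x∈M
  -- One splitting vertex serves for every `x`, since its `upper` contains the whole of `S T M`.
  ... | inj₂ x∈S = strong⊇M⇒⊇upper {T = T} {H} real modM v∈S strongM̃ M⊆M̃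
                     (S⊆upper {T = T} {H} real modM v∈S x∈S)
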